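{- Fix $\eta\in(0,1/3)$ and constants $0<a\le b$. For any $N\ge2$, $T\ge1$, any $\varepsilon$ with $a\frac{N^{1/3}}{T^{1/4}}\le\varepsilon\le b\frac{N^{1/3}}{T^{1/4}}$ and $\varepsilon\le\frac1{10}$, any SLAs with $\sum_i\beta(i)\le1$ and $\beta(i)\ge2\frac{\varepsilon}{N}$ for all $i$, any loads $L_1,\dots,L_T\in\mathbb{R}_{\ge0}^N$ and any user $i$, $$Q_T(i)\ \le\ Q_T'(i)+\mathcal{O}\!\left(N T^{3/4}\log(NT)\right),$$ where $Q_t$ is the queue given by Algorithm 1 (defined in the context) run with parameters $\varepsilon,\eta$, $Q_t'$ is the queue induced on the same loads by any dynamic policy $h_1',\dots,h_T'\in[0,1]^N$ with $h_t'(i)\le\beta(i)$ for all $t$, and the implied constant depends only on $\eta,a,b$.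
   Context: Model. There are $N\ge 2$ users sharing one resource of capacity $1$ over discrete times $t=1,\dots,T$. User $i$ has an SLA $\beta(i)\ge 0$. At time $t$ a load $L_t(i)\ge 0$ arrives for user $i$. Given allocations $h_1,\dots,h_T\in[0,1]^N$, the work and the queues are defined by $Q_1(i)=0$ and $$w_t(i)=\min\{h_t(i),\,L_t(i)+Q_t(i)\},\qquad Q_{t+1}(i)=\max\{0,\,L_t(i)+Q_t(i)-h_t(i)\}.$$ At time $t$ the only feedback is the set of active users $A_t=\{i: Q_t(i)>0\}$ and inactive users $B_t=\{1,\dots,N\}\setminus A_t$. Truncated simplex and projection. $\Delta_\varepsilon=\{x\in\mathbb{R}^N:\sum_i x(i)=1,\ x(i)\ge\varepsilon/N\ \forall i\}$, and for $y$ with positive entries $\pi_{\Delta_\varepsilon}(y)=\operatorname{argmin}_{x\in\Delta_\varepsilon}\sum_i x(i)\log(x(i)/y(i))$. Algorithm 1 (parameters $\varepsilon,\eta$). Set $\lambda=\frac{\varepsilon^2}{8N}$ and let $h_1$ be any element of $\Delta_\varepsilon$. For $t=1,\dots,T$: use allocation $h_t$; read $A_t,B_t$; let $A_t^1=\{i\in A_t:h_t(i)<\beta(i)\}$ and $A_t^2=A_t\setminus A_t^1$; set $g_t(i)=1+\lambda$ for $i\in A_t^1$, $g_t(i)=1$ for $i\in A_t^2$, $g_t(i)=0$ for $i\in B_t$; set $\widehat h_{t+1}(i)=h_t(i)e^{\eta g_t(i)}$ and $h_{t+1}=\pi_{\Delta_\varepsilon}(\widehat h_{t+1})$. -}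

module Defs where

open import Algebra.Bundles using (CommutativeRing)
open import Algebra.Structures using (IsCommutativeRing)
open import Data.Bool.Base using (if_then_else_)
open import Data.Fin.Base using (Fin)
open import Data.Nat.Base as ℕ using (ℕ; zero; suc)
open import Data.Product.Base using (_×_; ∃)
open import Level using (0ℓ)
open import Relation.Binary.Bundles using (DecTotalOrder)
open import Relation.Binary.Core using (Rel; _Preserves_⟶_)
open import Relation.Binary.Structures using (IsDecTotalOrder)
open import Relation.Nullary.Decidable using (Dec; does; ¬?; _×-dec_)
open import Relation.Nullary.Negation using (¬_)
open import Relation.Unary using (Pred)

-- The classical real numbers with exp and log, presented axiomatically: a
-- Dedekind-complete ordered field, which is unique up to isomorphism.
-- The values 0# ⁻¹ and log x for x ≤ 0# are unspecified junk.
record RealNumbers : Set₁ where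
  infix  4 _≈_ _≤_
  infixl 6 _+_
  infixl 7 _*_
  infix  8 -_
  infix  9 _⁻¹
  field
    Carrier : Set
    _≈_     : Rel Carrier 0ℓ
    _≤_     : Rel Carrier 0ℓ
    _+_ _*_ : Carrier → Carrier → Carrier
    -_ _⁻¹  : Carrier → Carrier
    0# 1#   : Carrier
    exp log : Carrier → Carrier

    isCommutativeRing : IsCommutativeRing _≈_ _+_ _*_ -_ 0# 1#
    1≉0               : ¬ (1# ≈ 0#)
    ⁻¹-cong           : _⁻¹ Preserves _≈_ ⟶ _≈_
    ⁻¹-inverseʳ       : ∀ {x} → ¬ (x ≈ 0#) → x * x ⁻¹ ≈ 1#

    isDecTotalOrder : IsDecTotalOrder _≈_ _≤_
    +-monoʳ-≤       : ∀ z {x y} → x ≤ y → z + x ≤ z + y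
    *-nonNeg        : ∀ {x y} → 0# ≤ x → 0# ≤ y → 0# ≤ x * y

  UpperBound : Pred Carrier 0ℓ → Carrier → Set
  UpperBound P u = ∀ x → P x → x ≤ u

  field
    supremum : ∀ (P : Pred Carrier 0ℓ) → ∃ P → ∃ (UpperBound P) →
               ∃ λ s → UpperBound P s × (∀ u → UpperBound P u → s ≤ u)

    -- These laws have exactly one solution: they give
    -- (1 + x/n)ⁿ ≤ exp x ≤ (1 - x/n)⁻ⁿ for all n > |x|.
    exp-cong  : exp Preserves _≈_ ⟶ _≈_
    exp-+     : ∀ x y → exp (x + y) ≈ exp x * exp y
    1+x≤exp-x : ∀ x → 1# + x ≤ exp x

    exp-log   : ∀ {x} → 0# ≤ x → ¬ (0# ≈ x) → exp (log x) ≈ x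

  commutativeRing : CommutativeRing 0ℓ 0ℓ
  commutativeRing = record { isCommutativeRing = isCommutativeRing }

  decTotalOrder : DecTotalOrder 0ℓ 0ℓ 0ℓ
  decTotalOrder = record { isDecTotalOrder = isDecTotalOrder }

  open import Relation.Binary.Construct.NonStrictToStrict _≈_ _≤_ public
    using (_<_)

  open IsDecTotalOrder isDecTotalOrder using (_≟_; _≤?_)

  infix 4 _<?_
  _<?_ : ∀ x y → Dec (x < y)
  x <? y = (x ≤? y) ×-dec ¬? (x ≟ y)

  open import Algebra.Construct.NaturalChoice.Max
    (DecTotalOrder.totalOrder decTotalOrder) public using (_⊔_)

  open import Algebra.Properties.Monoid.Sum
    (CommutativeRing.+-monoid commutativeRing) public using (sum)

  infixl 6 _-_
  _-_ : Carrier → Carrier → Carrier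
  x - y = x + - y

  infixl 7 _/_
  _/_ : Carrier → Carrier → Carrier
  x / y = x * y ⁻¹

  open import Algebra.Properties.Semiring.Mult
    (CommutativeRing.semiring commutativeRing) using () renaming (_×_ to _·_)

  fromℕ : ℕ → Carrier
  fromℕ n = n · 1#

  -- Real powers; meaningful for a positive base only.
  infixr 8 _^_
  _^_ : Carrier → Carrier → Carrier
  x ^ y = exp (y * log x)

module ResourceSharing (ℝ : RealNumbers) (N : ℕ) where
  open RealNumbers ℝ

  User : Set
  User = Fin N

  Vector : Set
  Vector = User → Carrier

  -- Times are 1, 2, …; the entry of a sequence at index 0 is never used.
  Sequence : Set
  Sequence = ℕ → Vector

  queue : (L h : Sequence) → Sequence
  queue L h zero          i = 0#
  queue L h (suc zero)    i = 0#
  queue L h (suc (suc t)) i =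
    0# ⊔ (L (suc t) i + queue L h (suc t) i - h (suc t) i)

  _∈Δ[_] : Vector → Carrier → Set
  x ∈Δ[ ε ] = sum x ≈ 1# × (∀ i → ε / fromℕ N ≤ x i)

  relativeEntropy : Vector → Vector → Carrier
  relativeEntropy x y = sum λ i → x i * log (x i / y i)

  -- x = π_{Δ_ε}(y), i.e. x minimises relativeEntropy _ y over Δ_ε.
  IsProjection : Carrier → Vector → Vector → Set
  IsProjection ε y x =
    x ∈Δ[ ε ] ×
    (∀ z → z ∈Δ[ ε ] → relativeEntropy x y ≤ relativeEntropy z y)

  module Algorithm (ε η : Carrier) (β : Vector) (L : Sequence) where

    λ₀ : Carrier
    λ₀ = (ε * ε) / (fromℕ 8 * fromℕ N)

    -- A_t as determined by the allocations h; its complement is B_t.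
    Active : Sequence → ℕ → User → Set
    Active h t i = 0# < queue L h t i

    active? : ∀ h t i → Dec (Active h t i)
    active? h t i = 0# <? queue L h t i

    -- h_t(i) < β(i) separates A_t¹ from A_t² inside A_t.
    gain : Sequence → Sequence
    gain h t i =
      if does (active? h t i)
      then (if does (h t i <? β i) then 1# + λ₀ else 1#)
      else 0#

    -- ĥ_{t+1}
    update : Sequence → ℕ → Vector
    update h t i = h t i * exp (η * gain h t i)

    -- The allocations h_1, …, h_{T+1} are produced by the algorithm.
    record IsRun (T : ℕ) (h : Sequence) : Set where
      field
        initial : h 1 ∈Δ[ ε ]
        step    : ∀ t → 1 ℕ.≤ t → t ℕ.≤ T →
                  IsProjection ε (update h t) (h (suc t))

{-# OPTIONS --safe #-}

-- Put λ = ε²/(8N) and θ = 1 - exp(-ηλ).  Comparing h_{t+1} with a vector that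
-- dominates a rescaled update and sums to at most 1 shows that for an active
-- user i one step multiplies h_t(i) by at least exp(-ηλ), and by at least
-- exp(θ(β(i) - h_t(i))) when h_t(i) < β(i): the latter because Σβ ≤ 1 ≤ Σh makes
-- the total surplus over the SLAs at least the deficit of i, and each surplus
-- shrinks by a factor exp(-ηλ) relative to h_t(i).  Hence, during a busy period of
-- i, the deficit accumulated until h_t(i) first reaches β(i) is at most
-- log(N/ε)/θ, and afterwards h_t(i) ≥ β(i) exp(-ηλ) costs at most θ per step.
-- With θ between ηλ/2 and ηλ both contributions are within the stated bound.
module Submission where

open import Defs
open import Algebra.Bundles using (CommutativeRing)
open import Algebra.Solver.Ring.AlmostCommutativeRing
  using (fromCommutativeRing; _-Raw-AlmostCommutative⟶_)
open import Data.Bool.Base using (if_then_else_)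
open import Data.Empty using (⊥)
open import Data.Fin.Base using (Fin; zero; suc)
open import Data.Fin.Properties as Fin using (any?)
open import Data.Integer.Base as ℤ using (ℤ; -[1+_])
open import Data.Integer.Properties as ℤ using ()
open import Data.Maybe.Base as Maybe using (Maybe)
open import Data.Nat.Base as ℕ using (ℕ; zero; suc)
open import Data.Nat.Properties as ℕ using ()
open import Data.Product.Base using (_×_; _,_; ∃; proj₁; proj₂)
open import Data.Sum.Base using (_⊎_; inj₁; inj₂)
open import Relation.Binary.Bundles using (DecTotalOrder)
open import Relation.Binary.PropositionalEquality.Core as ≡ using (_≡_)
import Relation.Binary.Reasoning.PartialOrder
import Relation.Binary.Reasoning.Setoid
open import Relation.Nullary.Decidable using (Dec; does; yes; no; dec⇒maybe; decidable-stable)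
open import Relation.Nullary.Negation using (¬_; contradiction)

-- The projection is known only as a minimiser, and the floor `ε / fromℕ N` may take mass from the
-- users above it, so the normalising factor of a step is not explicit. A comparison vector replaces
-- it: any vector that respects the floor, dominates the scaled update and has total at most 1
-- certifies a lower bound for all users at once. The bonus `λ₀` is what turns such a bound into
-- growth: without it all active users would be scaled alike, and a user below its SLA could gain
-- nothing on active users above theirs. The growth rate has to be proportional to the deficit,
-- because log h_t(i) then acts as a potential: it stays in the interval from log(ε/N) to 0, and
-- each unit of deficit raises it by at least θ. The size of `λ₀` is a trade-off: a larger bonus
-- shortens the climb, but lets a user that has reached its SLA fall further below it in one step.

module RealProperties (ℝ : RealNumbers) where
  open RealNumbers ℝ public
  open CommutativeRing commutativeRing public
    using (refl; reflexive; +-assoc; sym; trans; setoid; ring; semiring; +-commutativeMonoid;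
           +-cong; +-congˡ; +-congʳ; *-cong; *-congˡ; *-congʳ; -‿cong;
           +-identityˡ; +-identityʳ; *-identityˡ; *-identityʳ; *-comm; +-comm;
           *-assoc; zeroˡ; zeroʳ; -‿inverseʳ)
  open DecTotalOrder decTotalOrder public
    using (poset; antisym; total; ≤-respʳ-≈)
    renaming (refl to ≤-refl; trans to ≤-trans; reflexive to ≤-reflexive)
  import Relation.Binary.Construct.NonStrictToStrict _≈_ _≤_ as Strict
  module ≈-Reasoning = Relation.Binary.Reasoning.Setoid setoid
  module ≤-Reasoning = Relation.Binary.Reasoning.PartialOrder poset

  open import Algebra.Properties.Ring ring using (-‿distribˡ-*; -‿distribʳ-*; -0#≈0#; -‿+-comm; -‿involutive)
  open import Algebra.Properties.Semiring.Mult semiring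
    using (×1-homo-*) renaming (×-homo-+ to ·-homo-+)

  -- Integer coefficients for the ring solver.

  fromℤ : ℤ → Carrier
  fromℤ (ℤ.+ n)  = fromℕ n
  fromℤ -[1+ n ] = - fromℕ (suc n)

  fromℤ-neg : ∀ i → fromℤ (ℤ.- i) ≈ - fromℤ i
  fromℤ-neg (ℤ.+ zero)  = sym -0#≈0#
  fromℤ-neg (ℤ.+ suc n) = refl
  fromℤ-neg -[1+ n ]    = sym (-‿involutive _)

  fromℤ-⊖ : ∀ m n → fromℤ (m ℤ.⊖ n) ≈ fromℕ m - fromℕ n
  fromℤ-⊖ m       zero    = sym (trans (+-congˡ -0#≈0#) (+-identityʳ _))
  fromℤ-⊖ zero    (suc n) = sym (+-identityˡ _)
  fromℤ-⊖ (suc m) (suc n) = begin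
    fromℤ (suc m ℤ.⊖ suc n)                 ≡⟨ ≡.cong fromℤ (ℤ.[1+m]⊖[1+n]≡m⊖n m n) ⟩
    fromℤ (m ℤ.⊖ n)                         ≈⟨ fromℤ-⊖ m n ⟩
    fromℕ m - fromℕ n                       ≈⟨ +-congʳ (sym (+-identityˡ _)) ⟩
    0# + fromℕ m - fromℕ n                  ≈⟨ +-congʳ (+-congʳ (-‿inverseʳ 1#)) ⟨
    1# - 1# + fromℕ m - fromℕ n
      ≈⟨ +-congʳ (trans (+-assoc _ _ _) (trans (+-congˡ (+-comm _ _)) (sym (+-assoc _ _ _)))) ⟩
    1# + fromℕ m - 1# - fromℕ n             ≈⟨ trans (+-assoc _ _ _) (+-congˡ (-‿+-comm _ _)) ⟩
    fromℕ (suc m) - fromℕ (suc n)           ∎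
    where open ≈-Reasoning

  fromℤ-+ : ∀ i j → fromℤ (i ℤ.+ j) ≈ fromℤ i + fromℤ j
  fromℤ-+ (ℤ.+ m)  (ℤ.+ n)  = ·-homo-+ 1# m n
  fromℤ-+ (ℤ.+ m)  -[1+ n ] = fromℤ-⊖ m (suc n)
  fromℤ-+ -[1+ m ] (ℤ.+ n)  = trans (fromℤ-⊖ n (suc m)) (+-comm _ _)
  fromℤ-+ -[1+ m ] -[1+ n ] = begin
    - fromℕ (suc (suc (m ℕ.+ n)))           ≡⟨ ≡.cong (λ k → - fromℕ (suc k)) (ℕ.+-suc m n) ⟨
    - fromℕ (suc m ℕ.+ suc n)               ≈⟨ -‿cong (·-homo-+ 1# (suc m) (suc n)) ⟩
    - (fromℕ (suc m) + fromℕ (suc n))       ≈⟨ -‿+-comm _ _ ⟨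
    - fromℕ (suc m) - fromℕ (suc n)         ∎
    where open ≈-Reasoning

  fromℤ-+* : ∀ m j → fromℤ (ℤ.+ m ℤ.* j) ≈ fromℕ m * fromℤ j
  fromℤ-+* m (ℤ.+ n) = trans (reflexive (≡.cong fromℤ (≡.sym (ℤ.pos-* m n)))) (×1-homo-* m n)
  fromℤ-+* m -[1+ n ] = begin
    fromℤ (ℤ.+ m ℤ.* -[1+ n ])          ≡⟨ ≡.cong fromℤ (ℤ.neg-distribʳ-* (ℤ.+ m) (ℤ.+ suc n)) ⟨
    fromℤ (ℤ.- (ℤ.+ m ℤ.* ℤ.+ suc n))   ≈⟨ fromℤ-neg (ℤ.+ m ℤ.* ℤ.+ suc n) ⟩
    - fromℤ (ℤ.+ m ℤ.* ℤ.+ suc n)       ≈⟨ -‿cong (fromℤ-+* m (ℤ.+ suc n)) ⟩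
    - (fromℕ m * fromℕ (suc n))         ≈⟨ -‿distribʳ-* _ _ ⟩
    fromℕ m * - fromℕ (suc n)           ∎
    where open ≈-Reasoning

  fromℤ-* : ∀ i j → fromℤ (i ℤ.* j) ≈ fromℤ i * fromℤ j
  fromℤ-* (ℤ.+ m)  j = fromℤ-+* m j
  fromℤ-* -[1+ m ] j = begin
    fromℤ (-[1+ m ] ℤ.* j)              ≡⟨ ≡.cong fromℤ (ℤ.neg-distribˡ-* (ℤ.+ suc m) j) ⟨
    fromℤ (ℤ.- (ℤ.+ suc m ℤ.* j))       ≈⟨ fromℤ-neg (ℤ.+ suc m ℤ.* j) ⟩
    - fromℤ (ℤ.+ suc m ℤ.* j)           ≈⟨ -‿cong (fromℤ-+* (suc m) j) ⟩
    - (fromℕ (suc m) * fromℤ j)         ≈⟨ -‿distribˡ-* _ _ ⟩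
    - fromℕ (suc m) * fromℤ j           ∎
    where open ≈-Reasoning

  -- Sends 1 to 1# on the nose and n ≥ 2 to fromℕ n, so that the solver
  -- recognises both as constants.
  numeral : ℤ → Carrier
  numeral (ℤ.+ 1) = 1#
  numeral i       = fromℤ i

  numeral≈fromℤ : ∀ i → numeral i ≈ fromℤ i
  numeral≈fromℤ (ℤ.+ 0)             = refl
  numeral≈fromℤ (ℤ.+ 1)             = sym (+-identityʳ 1#)
  numeral≈fromℤ (ℤ.+ suc (suc n))   = refl
  numeral≈fromℤ -[1+ n ]            = refl

  numeral-morphism : ℤ.+-*-rawRing -Raw-AlmostCommutative⟶ fromCommutativeRing commutativeRing
  numeral-morphism = record
    { ⟦_⟧    = numeral
    ; +-homo = λ i j → trans (numeral≈fromℤ (i ℤ.+ j)) (trans (fromℤ-+ i j)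
                 (sym (+-cong (numeral≈fromℤ i) (numeral≈fromℤ j))))
    ; *-homo = λ i j → trans (numeral≈fromℤ (i ℤ.* j)) (trans (fromℤ-* i j)
                 (sym (*-cong (numeral≈fromℤ i) (numeral≈fromℤ j))))
    ; -‿homo = λ i → trans (numeral≈fromℤ (ℤ.- i)) (trans (fromℤ-neg i)
                 (sym (-‿cong (numeral≈fromℤ i))))
    ; 0-homo = refl
    ; 1-homo = refl
    }

  numeral-≟ : ∀ i j → Maybe (numeral i ≈ numeral j)
  numeral-≟ i j = Maybe.map (λ i≡j → reflexive (≡.cong numeral i≡j)) (dec⇒maybe (i ℤ.≟ j))

  open import Algebra.Solver.Ring ℤ.+-*-rawRing (fromCommutativeRing commutativeRing)
    numeral-morphism numeral-≟ public
    using (Polynomial; solve; con; _:+_; _:*_; _:-_; :-_; _:=_)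

  lit : ∀ {n} → ℕ → Polynomial n
  lit k = con (ℤ.+ k)

  -- Arithmetic of the ordered field.

  ≰⇒> : ∀ {x y} → ¬ (x ≤ y) → y < x
  ≰⇒> = Strict.≰⇒> sym ≤-reflexive total

  ≮⇒≥ : ∀ {x y} → ¬ (x < y) → y ≤ x
  ≮⇒≥ {x} {y} x≮y with total y x
  ... | inj₁ y≤x = y≤x
  ... | inj₂ x≤y = ≤-reflexive (sym (decidable-stable (x ≟ y) λ x≉y → x≮y (x≤y , x≉y)))
    where open DecTotalOrder decTotalOrder using (_≟_)

  <⇒≱ : ∀ {x y} → x < y → ¬ (y ≤ x)
  <⇒≱ = Strict.<⇒≱ antisym

  <-≤-trans : ∀ {x y z} → x < y → y ≤ z → x < z
  <-≤-trans = Strict.<-≤-trans sym ≤-trans antisym ≤-respʳ-≈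

  ≤-by : ∀ {x y d} → y ≈ x + d → 0# ≤ d → x ≤ y
  ≤-by {x} {y} {d} eq 0≤d = begin
    x      ≈⟨ +-identityʳ x ⟨
    x + 0# ≤⟨ +-monoʳ-≤ x 0≤d ⟩
    x + d  ≈⟨ eq ⟨
    y      ∎
    where open ≤-Reasoning

  <-by : ∀ {x y d} → y ≈ x + d → 0# < d → x < y
  <-by {x} {y} {d} eq 0<d = ≤-by eq (proj₁ 0<d) , λ x≈y → proj₂ 0<d (sym (begin
    d         ≈⟨ solve 2 (λ x d → d := x :+ d :- x) refl x d ⟩
    x + d - x ≈⟨ +-congʳ eq ⟨
    y - x     ≈⟨ +-congʳ x≈y ⟨
    x - x     ≈⟨ -‿inverseʳ x ⟩
    0#        ∎))
    where open ≈-Reasoning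

  x≤y⇒0≤y-x : ∀ {x y} → x ≤ y → 0# ≤ y - x
  x≤y⇒0≤y-x {x} {y} x≤y = begin
    0#      ≈⟨ -‿inverseʳ x ⟨
    x - x   ≈⟨ +-comm _ _ ⟩
    - x + x ≤⟨ +-monoʳ-≤ (- x) x≤y ⟩
    - x + y ≈⟨ +-comm _ _ ⟩
    y - x   ∎
    where open ≤-Reasoning

  x<y⇒0<y-x : ∀ {x y} → x < y → 0# < y - x
  x<y⇒0<y-x {x} {y} (x≤y , x≉y) = x≤y⇒0≤y-x x≤y , λ 0≈y-x → x≉y (begin
    x           ≈⟨ +-identityʳ x ⟨
    x + 0#      ≈⟨ +-congˡ 0≈y-x ⟩
    x + (y - x) ≈⟨ solve 2 (λ x y → x :+ (y :- x) := y) refl x y ⟩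
    y           ∎)
    where open ≈-Reasoning

  +-mono-≤ : ∀ {x y z w} → x ≤ y → z ≤ w → x + z ≤ y + w
  +-mono-≤ {x} {y} {z} {w} x≤y z≤w = begin
    x + z ≤⟨ +-monoʳ-≤ x z≤w ⟩
    x + w ≈⟨ +-comm x w ⟩
    w + x ≤⟨ +-monoʳ-≤ w x≤y ⟩
    w + y ≈⟨ +-comm w y ⟩
    y + w ∎
    where open ≤-Reasoning

  +-mono-<-≤ : ∀ {x y z w} → x < y → z ≤ w → x + z < y + w
  +-mono-<-≤ {x} {y} {z} {w} x<y z≤w = begin-strict
    x + z <⟨ <-by (solve 3 (λ x y z → y :+ z := x :+ z :+ (y :- x)) refl x y z) (x<y⇒0<y-x x<y) ⟩
    y + z ≤⟨ +-monoʳ-≤ y z≤w ⟩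
    y + w ∎
    where open ≤-Reasoning

  +-nonNeg : ∀ {x y} → 0# ≤ x → 0# ≤ y → 0# ≤ x + y
  +-nonNeg 0≤x 0≤y = ≤-trans (≤-reflexive (sym (+-identityˡ 0#))) (+-mono-≤ 0≤x 0≤y)

  +-pos : ∀ {x y} → 0# < x → 0# ≤ y → 0# < x + y
  +-pos {x} {y} 0<x 0≤y = begin-strict
    0#      ≈⟨ +-identityˡ 0# ⟨
    0# + 0# <⟨ +-mono-<-≤ 0<x 0≤y ⟩
    x + y   ∎
    where open ≤-Reasoning

  *-monoˡ-≤ : ∀ {x y z} → 0# ≤ z → x ≤ y → z * x ≤ z * y
  *-monoˡ-≤ {x} {y} {z} 0≤z x≤y =
    ≤-by (solve 3 (λ x y z → z :* y := z :* x :+ z :* (y :- x)) refl x y z)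
         (*-nonNeg 0≤z (x≤y⇒0≤y-x x≤y))

  *-monoʳ-≤ : ∀ {x y z} → 0# ≤ z → x ≤ y → x * z ≤ y * z
  *-monoʳ-≤ {x} {y} {z} 0≤z x≤y =
    ≤-by (solve 3 (λ x y z → y :* z := x :* z :+ z :* (y :- x)) refl x y z)
         (*-nonNeg 0≤z (x≤y⇒0≤y-x x≤y))

  *-mono-≤ : ∀ {x y z w} → 0# ≤ x → 0# ≤ w → x ≤ y → z ≤ w → x * z ≤ y * w
  *-mono-≤ 0≤x 0≤w x≤y z≤w = ≤-trans (*-monoˡ-≤ 0≤x z≤w) (*-monoʳ-≤ 0≤w x≤y)

  0≤x*x : ∀ x → 0# ≤ x * x
  0≤x*x x with total 0# x
  ... | inj₁ 0≤x = *-nonNeg 0≤x 0≤x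
  ... | inj₂ x≤0 = ≤-trans (*-nonNeg 0≤-x 0≤-x) (≤-reflexive (solve 1 (λ x → (lit 0 :- x) :* (lit 0 :- x) := x :* x) refl x))
    where
    0≤-x : 0# ≤ 0# - x
    0≤-x = x≤y⇒0≤y-x x≤0

  0≤1 : 0# ≤ 1#
  0≤1 = ≤-trans (0≤x*x 1#) (≤-reflexive (*-identityˡ 1#))

  0<1 : 0# < 1#
  0<1 = 0≤1 , λ 0≈1 → 1≉0 (sym 0≈1)

  pos⇒≉0 : ∀ {x} → 0# < x → ¬ (x ≈ 0#)
  pos⇒≉0 0<x x≈0 = proj₂ 0<x (sym x≈0)

  *-⁻¹-cancelˡ : ∀ {x} → 0# < x → ∀ y → x * (x ⁻¹ * y) ≈ y
  *-⁻¹-cancelˡ {x} 0<x y = begin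
    x * (x ⁻¹ * y) ≈⟨ *-assoc _ _ _ ⟨
    x * x ⁻¹ * y   ≈⟨ *-congʳ (⁻¹-inverseʳ (pos⇒≉0 0<x)) ⟩
    1# * y         ≈⟨ *-identityˡ y ⟩
    y              ∎
    where open ≈-Reasoning

  *-/-cancel : ∀ {y} → 0# < y → ∀ x → y * (x / y) ≈ x
  *-/-cancel {y} 0<y x = trans (*-congˡ (*-comm _ _)) (*-⁻¹-cancelˡ 0<y x)

  *-pos : ∀ {x y} → 0# < x → 0# < y → 0# < x * y
  *-pos {x} {y} 0<x 0<y = *-nonNeg (proj₁ 0<x) (proj₁ 0<y) , λ 0≈xy → proj₂ 0<y (begin
    0#             ≈⟨ zeroʳ _ ⟨
    x ⁻¹ * 0#      ≈⟨ *-congˡ 0≈xy ⟩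
    x ⁻¹ * (x * y) ≈⟨ solve 3 (λ x y z → z :* (x :* y) := x :* (z :* y)) refl x y (x ⁻¹) ⟩
    x * (x ⁻¹ * y) ≈⟨ *-⁻¹-cancelˡ 0<x y ⟩
    y              ∎)
    where open ≈-Reasoning

  *-monoˡ-< : ∀ {x y z} → 0# < z → x < y → z * x < z * y
  *-monoˡ-< {x} {y} {z} 0<z x<y =
    <-by (solve 3 (λ x y z → z :* y := z :* x :+ z :* (y :- x)) refl x y z)
         (*-pos 0<z (x<y⇒0<y-x x<y))

  *-cancelˡ-≤ : ∀ {x y z} → 0# < z → z * x ≤ z * y → x ≤ y
  *-cancelˡ-≤ 0<z zx≤zy = ≮⇒≥ λ y<x → <⇒≱ (*-monoˡ-< 0<z y<x) zx≤zy

  *-cancelˡ-< : ∀ {x y z} → 0# ≤ z → z * x < z * y → x < y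
  *-cancelˡ-< 0≤z zx<zy = ≰⇒> λ y≤x → <⇒≱ zx<zy (*-monoˡ-≤ 0≤z y≤x)

  ⁻¹-pos : ∀ {x} → 0# < x → 0# < x ⁻¹
  ⁻¹-pos {x} 0<x = *-cancelˡ-< (proj₁ 0<x) (begin-strict
    x * 0#   ≈⟨ zeroʳ x ⟩
    0#       <⟨ 0<1 ⟩
    1#       ≈⟨ ⁻¹-inverseʳ (pos⇒≉0 0<x) ⟨
    x * x ⁻¹ ∎)
    where open ≤-Reasoning

  /-pos : ∀ {x y} → 0# < x → 0# < y → 0# < x / y
  /-pos 0<x 0<y = *-pos 0<x (⁻¹-pos 0<y)

  fromℕ-nonNeg : ∀ n → 0# ≤ fromℕ n
  fromℕ-nonNeg zero    = ≤-refl
  fromℕ-nonNeg (suc n) = +-nonNeg 0≤1 (fromℕ-nonNeg n)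

  fromℕ-pos : ∀ n → 0# < fromℕ (suc n)
  fromℕ-pos n = +-pos 0<1 (fromℕ-nonNeg n)

  fromℕ-mono : ∀ {m n} → m ℕ.≤ n → fromℕ m ≤ fromℕ n
  fromℕ-mono {n = n} ℕ.z≤n = fromℕ-nonNeg n
  fromℕ-mono (ℕ.s≤s m≤n)   = +-monoʳ-≤ 1# (fromℕ-mono m≤n)

  1≤fromℕ : ∀ {n} → 1 ℕ.≤ n → 1# ≤ fromℕ n
  1≤fromℕ 1≤n = ≤-trans (≤-reflexive (sym (+-identityʳ 1#))) (fromℕ-mono 1≤n)

  -- Exponential and logarithm.

  1≤exp : ∀ {x} → 0# ≤ x → 1# ≤ exp x
  1≤exp {x} 0≤x = ≤-trans (≤-by refl 0≤x) (1+x≤exp-x x)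

  *-cancelˡ-≈ : ∀ {x y z} → 0# < z → z * x ≈ z * y → x ≈ y
  *-cancelˡ-≈ 0<z zx≈zy =
    antisym (*-cancelˡ-≤ 0<z (≤-reflexive zx≈zy)) (*-cancelˡ-≤ 0<z (≤-reflexive (sym zx≈zy)))

  exp-0 : exp 0# ≈ 1#
  exp-0 = *-cancelˡ-≈ {z = exp 0#} 0<exp-0 (begin
    exp 0# * exp 0# ≈⟨ exp-+ 0# 0# ⟨
    exp (0# + 0#)   ≈⟨ exp-cong (+-identityˡ 0#) ⟩
    exp 0#          ≈⟨ *-identityʳ _ ⟨
    exp 0# * 1#     ∎)
    where
    open ≈-Reasoning
    0<exp-0 : 0# < exp 0#
    0<exp-0 = <-≤-trans 0<1 (1≤exp ≤-refl)

  exp-inverseˡ : ∀ x → exp (- x) * exp x ≈ 1#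
  exp-inverseˡ x = begin
    exp (- x) * exp x ≈⟨ exp-+ (- x) x ⟨
    exp (- x + x)     ≈⟨ exp-cong (trans (+-comm _ _) (-‿inverseʳ x)) ⟩
    exp 0#            ≈⟨ exp-0 ⟩
    1#                ∎
    where open ≈-Reasoning

  -- For x ≥ 0 the bound 1 + x ≤ exp x suffices; for x ≤ 0 the value is a factor of exp(-x) · exp x
  -- = 1, whose other factor is at least 1.
  exp-pos : ∀ x → 0# < exp x
  exp-pos x with total 0# x
  ... | inj₁ 0≤x = begin-strict 0# <⟨ 0<1 ⟩ 1# ≤⟨ 1≤exp 0≤x ⟩ exp x ∎
    where open ≤-Reasoning
  ... | inj₂ x≤0 = *-cancelˡ-< {z = exp (- x)} (≤-trans 0≤1 (1≤exp 0≤-x)) (begin-strict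
    exp (- x) * 0#    ≈⟨ zeroʳ _ ⟩
    0#                <⟨ 0<1 ⟩
    1#                ≈⟨ exp-inverseˡ x ⟨
    exp (- x) * exp x ∎)
    where
    open ≤-Reasoning
    0≤-x : 0# ≤ - x
    0≤-x = ≤-trans (x≤y⇒0≤y-x x≤0) (≤-reflexive (+-identityˡ _))

  exp-difference : ∀ x y → exp x * exp (y - x) ≈ exp y
  exp-difference x y = trans (sym (exp-+ x (y - x)))
    (exp-cong (solve 2 (λ x y → x :+ (y :- x) := y) refl x y))

  exp-mono-< : ∀ {x y} → x < y → exp x < exp y
  exp-mono-< {x} {y} x<y = begin-strict
    exp x               ≈⟨ *-identityʳ _ ⟨
    exp x * 1#          <⟨ *-monoˡ-< (exp-pos x) (<-by refl (x<y⇒0<y-x x<y)) ⟩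
    exp x * (1# + (y - x)) ≤⟨ *-monoˡ-≤ (proj₁ (exp-pos x)) (1+x≤exp-x (y - x)) ⟩
    exp x * exp (y - x) ≈⟨ exp-difference x y ⟩
    exp y               ∎
    where open ≤-Reasoning

  exp-cancel-≤ : ∀ {x y} → exp x ≤ exp y → x ≤ y
  exp-cancel-≤ ex≤ey = ≮⇒≥ λ y<x → <⇒≱ (exp-mono-< y<x) ex≤ey

  exp-mono-≤ : ∀ {x y} → x ≤ y → exp x ≤ exp y
  exp-mono-≤ {x} {y} x≤y = begin
    exp x               ≈⟨ *-identityʳ _ ⟨
    exp x * 1#          ≤⟨ *-monoˡ-≤ (proj₁ (exp-pos x)) (1≤exp (x≤y⇒0≤y-x x≤y)) ⟩
    exp x * exp (y - x) ≈⟨ exp-difference x y ⟩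
    exp y               ∎
    where open ≤-Reasoning

  exp-cancel-< : ∀ {x y} → exp x < exp y → x < y
  exp-cancel-< ex<ey = ≰⇒> λ y≤x → <⇒≱ ex<ey (exp-mono-≤ y≤x)

  exp-log-pos : ∀ {x} → 0# < x → exp (log x) ≈ x
  exp-log-pos 0<x = exp-log (proj₁ 0<x) (proj₂ 0<x)

  log-mono-≤ : ∀ {x y} → 0# < x → 0# < y → x ≤ y → log x ≤ log y
  log-mono-≤ {x} {y} 0<x 0<y x≤y = exp-cancel-≤ (begin
    exp (log x) ≈⟨ exp-log-pos 0<x ⟩
    x           ≤⟨ x≤y ⟩
    y           ≈⟨ exp-log-pos 0<y ⟨
    exp (log y) ∎)
    where open ≤-Reasoning

  log-mono-< : ∀ {x y} → 0# < x → 0# < y → x < y → log x < log y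
  log-mono-< {x} {y} 0<x 0<y x<y = exp-cancel-< (begin-strict
    exp (log x) ≈⟨ exp-log-pos 0<x ⟩
    x           <⟨ x<y ⟩
    y           ≈⟨ exp-log-pos 0<y ⟨
    exp (log y) ∎)
    where open ≤-Reasoning

  1/2 : Carrier
  1/2 = fromℕ 2 ⁻¹

  halve : ∀ x → x * 1/2 + x * 1/2 ≈ x
  halve x = trans (solve 2 (λ x h → x :* h :+ x :* h := lit 2 :* (x :* h)) refl x 1/2)
                  (*-/-cancel (fromℕ-pos 1) x)

  0<x/2<x : ∀ {x} → 0# < x → 0# < x * 1/2 × x * 1/2 < x
  0<x/2<x {x} 0<x = 0<x/2 , <-by (sym (halve x)) 0<x/2
    where
    0<x/2 : 0# < x * 1/2
    0<x/2 = *-pos 0<x (⁻¹-pos (fromℕ-pos 1))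

  -- Provides the amount of mass for the perturbation of the projection, which has to stay below two
  -- gaps at once.
  ∃-smaller : ∀ {x y} → 0# < x → 0# < y → ∃ λ s → 0# < s × s < x × s < y
  ∃-smaller {x} {y} 0<x 0<y with total x y
  ... | inj₁ x≤y = let 0<s , s<x = 0<x/2<x 0<x in
    x * 1/2 , 0<s , s<x , <-≤-trans s<x x≤y
  ... | inj₂ y≤x = let 0<s , s<y = 0<x/2<x 0<y in
    y * 1/2 , 0<s , <-≤-trans s<y y≤x , s<y

  -- Finite sums.

  open import Algebra.Properties.CommutativeMonoid.Sum +-commutativeMonoid public
    using (∑-distrib-+; sum-replicate-zero)
  open import Algebra.Properties.Semiring.Sum semiring public
    using (*-distribˡ-sum; *-distribʳ-sum)

  sum-mono-≤ : ∀ {n} {s t : Fin n → Carrier} → (∀ k → s k ≤ t k) → sum s ≤ sum t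
  sum-mono-≤ {zero}  s≤t = ≤-refl
  sum-mono-≤ {suc n} s≤t = +-mono-≤ (s≤t zero) (sum-mono-≤ λ k → s≤t (suc k))

  sum-mono-< : ∀ {n} {s t : Fin n → Carrier} →
               (∀ k → s k ≤ t k) → ∀ i → s i < t i → sum s < sum t
  sum-mono-< s≤t zero    si<ti = +-mono-<-≤ si<ti (sum-mono-≤ λ k → s≤t (suc k))
  sum-mono-< {s = s} {t} s≤t (suc i) si<ti = begin-strict
    s zero + sum (λ k → s (suc k)) ≈⟨ +-comm _ _ ⟩
    sum (λ k → s (suc k)) + s zero
      <⟨ +-mono-<-≤ (sum-mono-< (λ k → s≤t (suc k)) i si<ti) (s≤t zero) ⟩
    sum (λ k → t (suc k)) + t zero ≈⟨ +-comm _ _ ⟩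
    t zero + sum (λ k → t (suc k)) ∎
    where open ≤-Reasoning

  sum-nonNeg : ∀ {n} {t : Fin n → Carrier} → (∀ k → 0# ≤ t k) → 0# ≤ sum t
  sum-nonNeg {n} 0≤t = ≤-trans (≤-reflexive (sym (sum-replicate-zero n))) (sum-mono-≤ 0≤t)

  term≤sum : ∀ {n} {t : Fin n → Carrier} → (∀ k → 0# ≤ t k) → ∀ i → t i ≤ sum t
  term≤sum 0≤t zero    = ≤-by refl (sum-nonNeg λ k → 0≤t (suc k))
  term≤sum 0≤t (suc i) = ≤-trans (term≤sum (λ k → 0≤t (suc k)) i) (≤-by (+-comm _ _) (0≤t zero))

  -- Contrapositive of `sum-mono-<`; since `_<_` is decidable and there are finitely many indices,
  -- the witness is found by search.
  sum-≤⇒∃-> : ∀ {n} {s t : Fin n → Carrier} → sum s ≤ sum t →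
              ∀ i → t i < s i → ∃ λ j → s j < t j
  sum-≤⇒∃-> {s = s} {t} Σs≤Σt i ti<si with any? (λ j → s j <? t j)
  ... | yes ∃j = ∃j
  ... | no ∄j  = contradiction Σs≤Σt
    (<⇒≱ (sum-mono-< (λ k → ≮⇒≥ λ sk<tk → ∄j (k , sk<tk)) i ti<si))

  -- A point mass, by recursion on the index rather than by a test for equality, so that `sum`
  -- unfolds along it.
  single : ∀ {n} → Fin n → Carrier → Fin n → Carrier
  single zero    s zero    = s
  single zero    s (suc k) = 0#
  single (suc i) s zero    = 0#
  single (suc i) s (suc k) = single i s k

  sum-single : ∀ {n} (i : Fin n) s → sum (single i s) ≈ s
  sum-single {suc n} zero s = trans (+-congˡ (sum-replicate-zero n)) (+-identityʳ s)
  sum-single (suc i) s = trans (+-identityˡ _) (sum-single i s)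

  single-≡ : ∀ {n} (i : Fin n) s → single i s i ≡ s
  single-≡ zero    s = ≡.refl
  single-≡ (suc i) s = single-≡ i s

  single-≢ : ∀ {n} {i k : Fin n} s → ¬ (k ≡ i) → single i s k ≡ 0#
  single-≢ {i = zero}  {zero}  s k≢i = contradiction ≡.refl k≢i
  single-≢ {i = zero}  {suc k} s k≢i = ≡.refl
  single-≢ {i = suc i} {zero}  s k≢i = ≡.refl
  single-≢ {i = suc i} {suc k} s k≢i = single-≢ s λ k≡i → k≢i (≡.cong suc k≡i)

  sum-distrib-- : ∀ {n} (s t : Fin n → Carrier) → sum (λ k → s k - t k) ≈ sum s - sum t
  sum-distrib-- {zero}  s t = sym (-‿inverseʳ 0#)
  sum-distrib-- {suc n} s t = trans (+-congˡ (sum-distrib-- (λ k → s (suc k)) (λ k → t (suc k))))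
    (solve 4 (λ a b c d → a :- b :+ (c :- d) := a :+ c :- (b :+ d)) refl (s zero) (t zero) _ _)

-- Lower bounds for the entropy projection by perturbation.

module EntropyProjection (ℝ : RealNumbers) (N : ℕ) where
  open RealProperties ℝ
  open ResourceSharing ℝ N using (Vector; relativeEntropy; IsProjection)

  -- The tangent at w of the convex function v ↦ v log (v/y).
  entropy-tangent : ∀ {v w y} → 0# < v → 0# < w → 0# < y →
                    w * log (w / y) ≤ v * log (v / y) + (w - v) * (1# + log (w / y))
  entropy-tangent {v} {w} {y} 0<v 0<w 0<y =
    ≤-by (solve 4 (λ v w p q → v :* p :+ (w :- v) :* (lit 1 :+ q) :=
                               w :* q :+ (w :- v :* (lit 1 :+ (q :- p))))
                  refl v w (log (v / y)) (log (w / y)))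
         (x≤y⇒0≤y-x (begin
           v * (1# + (log (w / y) - log (v / y)))      ≤⟨ *-monoˡ-≤ (proj₁ 0<v) (1+x≤exp-x _) ⟩
           v * exp (log (w / y) - log (v / y))         ≈⟨ *-congʳ (recover 0<v) ⟨
           y * exp (log (v / y)) * exp (log (w / y) - log (v / y)) ≈⟨ *-assoc _ _ _ ⟩
           y * (exp (log (v / y)) * exp (log (w / y) - log (v / y)))
             ≈⟨ *-congˡ (exp-difference _ _) ⟩
           y * exp (log (w / y))                       ≈⟨ recover 0<w ⟩
           w                                           ∎))
    where
    open ≤-Reasoning
    recover : ∀ {u} → 0# < u → y * exp (log (u / y)) ≈ u
    recover 0<u = trans (*-congˡ (exp-log-pos (/-pos 0<u 0<y))) (*-/-cancel 0<y _)

  -- The tangent is taken at the new point `z`, so convexity bounds the new entropy from above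
  -- without a second-order error. The slope is split at a level `r` common to all coordinates: the
  -- terms with 1 + `r` cancel in the sum when the total mass is preserved, and only the sign of the
  -- last term matters.
  entropy-move : ∀ {x y z d} r → 0# < x → 0# < z → 0# < y → z ≈ x + d →
                 z * log (z / y) ≤ x * log (x / y) + d * (1# + r) + d * (log (z / y) - r)
  entropy-move {x} {y} {z} {d} r 0<x 0<z 0<y z≈x+d = begin
    z * log (z / y)
      ≤⟨ entropy-tangent 0<x 0<z 0<y ⟩
    x * log (x / y) + (z - x) * (1# + log (z / y))
      ≈⟨ +-congˡ (*-congʳ (+-congʳ z≈x+d)) ⟩
    x * log (x / y) + (x + d - x) * (1# + log (z / y))
      ≈⟨ solve 5 (λ x d r p q → x :* p :+ (x :+ d :- x) :* (lit 1 :+ q) :=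
                                x :* p :+ d :* (lit 1 :+ r) :+ d :* (q :- r))
           refl x d r (log (x / y)) (log (z / y)) ⟩
    x * log (x / y) + d * (1# + r) + d * (log (z / y) - r) ∎
    where open ≤-Reasoning

  -- If x i < y i * ρ, some j has x j > c j ≥ y j * ρ, and moving a little mass
  -- from j to i decreases the relative entropy.
  projection-lower-bound :
    ∀ {ε x y c ρ} → 0# < ε / fromℕ N → (∀ k → 0# < y k) → 0# < ρ →
    IsProjection ε y x →
    (∀ k → ε / fromℕ N ≤ c k) → (∀ k → y k * ρ ≤ c k) → sum c ≤ 1# →
    ∀ i → y i * ρ ≤ x i
  projection-lower-bound {ε} {x} {y} {c} {ρ} 0<μ 0<y 0<ρ ((Σx≈1 , μ≤x) , minimal) μ≤c yρ≤c Σc≤1 i =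
    ≮⇒≥ λ xi<yiρ → improve xi<yiρ (sum-≤⇒∃-> (≤-trans Σc≤1 (≤-reflexive (sym Σx≈1))) i
                                      (<-≤-trans xi<yiρ (yρ≤c i)))
    where
    open ≤-Reasoning

    above-μ⇒pos : ∀ {u} → ε / fromℕ N ≤ u → 0# < u
    above-μ⇒pos = <-≤-trans 0<μ

    improve : x i < y i * ρ → (∃ λ j → c j < x j) → ⊥
    improve xi<yiρ (j , cj<xj) with ∃-smaller (x<y⇒0<y-x xi<yiρ) (x<y⇒0<y-x cj<xj)
    ... | s , 0<s , s<gapᵢ , s<gapⱼ = <⇒≱ better (minimal z (Σz≈1 , μ≤z))
      where
      r : Carrier
      r = log ρ

      d z : Vector
      d k = single i s k + single j (- s) k
      z k = x k + d k

      i≢j : ¬ (i ≡ j)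
      i≢j ≡.refl = <⇒≱ (<-≤-trans xi<yiρ (yρ≤c i)) (proj₁ cj<xj)

      di≈s : d i ≈ s
      di≈s = trans (+-cong (reflexive (single-≡ i s)) (reflexive (single-≢ (- s) i≢j))) (+-identityʳ s)

      dj≈-s : d j ≈ - s
      dj≈-s = trans (+-cong (reflexive (single-≢ s λ j≡i → i≢j (≡.sym j≡i))) (reflexive (single-≡ j (- s))))
                    (+-identityˡ (- s))

      dk≈0 : ∀ {k} → ¬ (k ≡ i) → ¬ (k ≡ j) → d k ≈ 0#
      dk≈0 k≢i k≢j = trans (+-cong (reflexive (single-≢ s k≢i)) (reflexive (single-≢ (- s) k≢j)))
                           (+-identityˡ 0#)

      Σd≈0 : sum d ≈ 0#
      Σd≈0 = begin-equality
        sum d                                       ≈⟨ ∑-distrib-+ (single i s) (single j (- s)) ⟩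
        sum (single i s) + sum (single j (- s))
          ≈⟨ +-cong (sum-single i s) (sum-single j (- s)) ⟩
        s - s                                       ≈⟨ -‿inverseʳ s ⟩
        0#                                          ∎

      Σz≈1 : sum z ≈ 1#
      Σz≈1 = begin-equality
        sum z         ≈⟨ ∑-distrib-+ x d ⟩
        sum x + sum d ≈⟨ +-cong Σx≈1 Σd≈0 ⟩
        1# + 0#       ≈⟨ +-identityʳ 1# ⟩
        1#            ∎

      cj≤zj : c j ≤ z j
      cj≤zj = begin
        c j         ≤⟨ ≤-by (solve 3 (λ c x s → x :- s := c :+ (x :- c :- s)) refl (c j) (x j) s)
                            (x≤y⇒0≤y-x (proj₁ s<gapⱼ)) ⟩
        x j - s     ≈⟨ +-congˡ dj≈-s ⟨
        z j         ∎

      zi<yiρ : z i < y i * ρ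
      zi<yiρ = begin-strict
        z i         ≈⟨ +-congˡ di≈s ⟩
        x i + s
          <⟨ <-by (solve 3 (λ x u s → u := x :+ s :+ (u :- x :- s)) refl (x i) (y i * ρ) s)
                            (x<y⇒0<y-x s<gapᵢ) ⟩
        y i * ρ     ∎

      -- Only `j` loses mass, and it stays above `c j`. This is why `c` has to respect the floor of
      -- the truncated simplex.
      μ≤z : ∀ k → ε / fromℕ N ≤ z k
      μ≤z k with k Fin.≟ i | k Fin.≟ j
      ... | yes ≡.refl | _          = ≤-trans (μ≤x i) (≤-by (+-congˡ di≈s) (proj₁ 0<s))
      ... | no _       | yes ≡.refl = ≤-trans (μ≤c j) cj≤zj
      ... | no k≢i     | no k≢j     =
        ≤-trans (μ≤x k) (≤-reflexive (sym (trans (+-congˡ (dk≈0 k≢i k≢j)) (+-identityʳ _))))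

      -- With the level `r` = log ρ, the sign of this term compares z/y with ρ: user `i` gains mass
      -- while still below ρ, and user `j` loses mass while at or above ρ.
      slack : Vector
      slack k = d k * (log (z k / y k) - r)

      z/y>0 : ∀ k → 0# < z k / y k
      z/y>0 k = /-pos (above-μ⇒pos (μ≤z k)) (0<y k)

      slackᵢ<0 : slack i < 0#
      slackᵢ<0 = <-by (begin-equality
        0#
          ≈⟨ solve 2 (λ d u → lit 0 := d :* u :- d :* u) refl (d i) (log (z i / y i) - r) ⟩
        slack i - slack i   ≈⟨ +-congˡ (-‿cong (*-congʳ di≈s)) ⟩
        slack i - s * (log (z i / y i) - r)
          ≈⟨ solve 4 (λ k s q r → k :- s :* (q :- r) := k :+ s :* (r :- q)) refl (slack i) s (log (z i / y i)) r ⟩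
        slack i + s * (r - log (z i / y i)) ∎)
        (*-pos 0<s (x<y⇒0<y-x (log-mono-< (z/y>0 i) 0<ρ (*-cancelˡ-< (proj₁ (0<y i)) (begin-strict
          y i * (z i / y i) ≈⟨ *-/-cancel (0<y i) (z i) ⟩
          z i               <⟨ zi<yiρ ⟩
          y i * ρ           ∎)))))

      slackⱼ≤0 : slack j ≤ 0#
      slackⱼ≤0 = ≤-by (begin-equality
        0#
          ≈⟨ solve 2 (λ d u → lit 0 := d :* u :- d :* u) refl (d j) (log (z j / y j) - r) ⟩
        slack j - slack j   ≈⟨ +-congˡ (-‿cong (*-congʳ dj≈-s)) ⟩
        slack j - - s * (log (z j / y j) - r)
          ≈⟨ solve 4 (λ k s q r → k :- :- s :* (q :- r) := k :+ s :* (q :- r)) refl (slack j) s (log (z j / y j)) r ⟩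
        slack j + s * (log (z j / y j) - r) ∎)
        (*-nonNeg (proj₁ 0<s) (x≤y⇒0≤y-x (log-mono-≤ 0<ρ (z/y>0 j) (*-cancelˡ-≤ (0<y j) (begin
          y j * ρ           ≤⟨ yρ≤c j ⟩
          c j               ≤⟨ cj≤zj ⟩
          z j               ≈⟨ *-/-cancel (0<y j) (z j) ⟨
          y j * (z j / y j) ∎)))))

      slack≤0 : ∀ k → slack k ≤ 0#
      slack≤0 k with k Fin.≟ i | k Fin.≟ j
      ... | yes ≡.refl | _          = proj₁ slackᵢ<0
      ... | no _       | yes ≡.refl = slackⱼ≤0
      ... | no k≢i     | no k≢j     = ≤-reflexive (trans (*-congʳ (dk≈0 k≢i k≢j)) (zeroˡ _))

      linear : Vector
      linear k = x k * log (x k / y k) + d k * (1# + r)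

      z-below-slack : ∀ k → z k * log (z k / y k) ≤ linear k + slack k
      z-below-slack k = entropy-move r (above-μ⇒pos (μ≤x k)) (above-μ⇒pos (μ≤z k)) (0<y k) refl

      better : relativeEntropy z y < relativeEntropy x y
      better = begin-strict
        relativeEntropy z y
          <⟨ sum-mono-< (λ k → begin
               z k * log (z k / y k) ≤⟨ z-below-slack k ⟩
               linear k + slack k    ≤⟨ +-monoʳ-≤ (linear k) (slack≤0 k) ⟩
               linear k + 0#         ≈⟨ +-identityʳ _ ⟩
               linear k              ∎) i (begin-strict
               z i * log (z i / y i) ≤⟨ z-below-slack i ⟩
               linear i + slack i    ≈⟨ +-comm _ _ ⟩
               slack i + linear i    <⟨ +-mono-<-≤ slackᵢ<0 ≤-refl ⟩
               0# + linear i         ≈⟨ +-identityˡ _ ⟩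
               linear i              ∎) ⟩
        sum linear
          ≈⟨ ∑-distrib-+ (λ k → x k * log (x k / y k)) (λ k → d k * (1# + r)) ⟩
        relativeEntropy x y + sum (λ k → d k * (1# + r))
          ≈⟨ +-congˡ (*-distribʳ-sum (1# + r) d) ⟨
        relativeEntropy x y + sum d * (1# + r)
          ≈⟨ +-congˡ (trans (*-congʳ Σd≈0) (zeroˡ _)) ⟩
        relativeEntropy x y + 0#
          ≈⟨ +-identityʳ _ ⟩
        relativeEntropy x y ∎

if-yes : ∀ {A P : Set} (P? : Dec P) {x y : A} → P → (if does P? then x else y) ≡ x
if-yes (yes _) p = ≡.refl
if-yes (no ¬p) p = contradiction p ¬p

if-no : ∀ {A P : Set} (P? : Dec P) {x y : A} → ¬ P → (if does P? then x else y) ≡ y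
if-no (yes p) ¬p = contradiction p ¬p
if-no (no _)  ¬p = ≡.refl

-- Queue recurrences and the behaviour of a run.

module Dynamics (ℝ : RealNumbers) (N : ℕ) where
  open RealProperties ℝ
  open ResourceSharing ℝ N
  open EntropyProjection ℝ N
  open import Algebra.Construct.NaturalChoice.Max
    (DecTotalOrder.totalOrder decTotalOrder) using (⊔-sel; x≤x⊔y; x≤y⊔x)

  queue-nonNeg : ∀ L h t i → 0# ≤ queue L h t i
  queue-nonNeg L h zero          i = ≤-refl
  queue-nonNeg L h (suc zero)    i = ≤-refl
  queue-nonNeg L h (suc (suc t)) i = x≤x⊔y _ _

  queue-step-≥ : ∀ L h t i →
    L (suc t) i + queue L h (suc t) i - h (suc t) i ≤ queue L h (suc (suc t)) i
  queue-step-≥ L h t i = x≤y⊔x _ _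

  -- A positive maximum with 0 is attained at its other argument. Hence the comparison of queues can
  -- be propagated only into times at which the user is active.
  queue-step-≤ : ∀ L h t i → 0# < queue L h (suc (suc t)) i →
    queue L h (suc (suc t)) i ≤ L (suc t) i + queue L h (suc t) i - h (suc t) i
  queue-step-≤ L h t i 0<Q with ⊔-sel 0# (L (suc t) i + queue L h (suc t) i - h (suc t) i)
  ... | inj₁ Q≈0 = contradiction (≤-reflexive Q≈0) (<⇒≱ 0<Q)
  ... | inj₂ Q≈  = ≤-reflexive Q≈

  -- Both queues receive the same load, so the loads cancel and the gap grows by at most h' - h ≤ β
  -- - h. The reference queue needs only the lower half of its recurrence, which holds whether or
  -- not it empties.
  excess-step : ∀ {β D} L h h' t i →
    0# < queue L h (suc (suc t)) i → h' (suc t) i ≤ β →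
    queue L h (suc t) i ≤ queue L h' (suc t) i + D →
    queue L h (suc (suc t)) i ≤ queue L h' (suc (suc t)) i + (D + (β - h (suc t) i))
  excess-step {β} {D} L h h' t i 0<Q h'≤β Q≤Q'+D = ≤-by
    (solve 9 (λ Q₂ Q₂' D β h l Q₁ Q₁' h' →
       Q₂' :+ (D :+ (β :- h)) :=
       Q₂ :+ ((l :+ Q₁ :- h :- Q₂) :+ (Q₂' :- (l :+ Q₁' :- h')) :+ ((Q₁' :+ D :- Q₁) :+ (β :- h'))))
       refl (queue L h (suc (suc t)) i) (queue L h' (suc (suc t)) i) D β (h (suc t) i)
            (L (suc t) i) (queue L h (suc t) i) (queue L h' (suc t) i) (h' (suc t) i))
    (+-nonNeg (+-nonNeg (x≤y⇒0≤y-x (queue-step-≤ L h t i 0<Q)) (x≤y⇒0≤y-x (queue-step-≥ L h' t i)))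
              (+-nonNeg (x≤y⇒0≤y-x Q≤Q'+D) (x≤y⇒0≤y-x h'≤β)))

  module _ {ε η : Carrier} {β : Vector} {L : Sequence} where
    open Algorithm ε η β L

    module Run
      (0<ε/N : 0# < ε / fromℕ N) (0<η : 0# < η) (0<λ : 0# < λ₀)
      (ε/N≤β : ∀ k → ε / fromℕ N ≤ β k) (Σβ≤1 : sum β ≤ 1#)
      {T : ℕ} {h : Sequence} (run : IsRun T h)
      where
      open ≤-Reasoning

      μ decay θ : Carrier
      μ     = ε / fromℕ N
      decay = exp (- (η * λ₀))
      θ     = 1# - decay

      0<θ : 0# < θ
      0<θ = x<y⇒0<y-x (begin-strict
        decay
          <⟨ exp-mono-< (<-by (solve 1 (λ a → lit 0 := :- a :+ a) refl (η * λ₀)) (*-pos 0<η 0<λ)) ⟩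
        exp 0#          ≈⟨ exp-0 ⟩
        1#              ∎)

      0≤θ : 0# ≤ θ
      0≤θ = proj₁ 0<θ

      0<β : ∀ k → 0# < β k
      0<β k = <-≤-trans 0<ε/N (ε/N≤β k)

      β≤1 : ∀ k → β k ≤ 1#
      β≤1 k = ≤-trans (term≤sum (λ j → proj₁ (0<β j)) k) Σβ≤1

      -- The index is shifted because times start at 1; the case `t` = `T` is the allocation
      -- produced by the last step.
      allocation∈Δ : ∀ t → t ℕ.≤ T → h (suc t) ∈Δ[ ε ]
      allocation∈Δ zero    _   = IsRun.initial run
      allocation∈Δ (suc t) t<T = proj₁ (IsRun.step run (suc t) (ℕ.s≤s ℕ.z≤n) t<T)

      ε/N≤allocation : ∀ {t} → t ℕ.≤ T → ∀ k → μ ≤ h (suc t) k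
      ε/N≤allocation t≤T = proj₂ (allocation∈Δ _ t≤T)

      0≤allocation : ∀ {t} → t ℕ.≤ T → ∀ k → 0# ≤ h (suc t) k
      0≤allocation t≤T k = ≤-trans (proj₁ 0<ε/N) (ε/N≤allocation t≤T k)

      allocation≤1 : ∀ {t} → t ℕ.≤ T → ∀ k → h (suc t) k ≤ 1#
      allocation≤1 t≤T k =
        ≤-trans (term≤sum (0≤allocation t≤T) k) (≤-reflexive (proj₁ (allocation∈Δ _ t≤T)))

      gain-climbing : ∀ {t k} → Active h t k → h t k < β k → gain h t k ≡ 1# + λ₀
      gain-climbing {t} {k} a h<β = ≡.trans (if-yes (active? h t k) a) (if-yes (h t k <? β k) h<β)

      gain-settled : ∀ {t k} → Active h t k → ¬ (h t k < β k) → gain h t k ≡ 1#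
      gain-settled {t} {k} a h≮β = ≡.trans (if-yes (active? h t k) a) (if-no (h t k <? β k) h≮β)

      gain-inactive : ∀ {t k} → ¬ Active h t k → gain h t k ≡ 0#
      gain-inactive {t} {k} ¬a = if-no (active? h t k) ¬a

      1≤1+λ : 1# ≤ 1# + λ₀
      1≤1+λ = ≤-by refl (proj₁ 0<λ)

      gain≤1+λ : ∀ t k → gain h t k ≤ 1# + λ₀
      gain≤1+λ t k with active? h t k | h t k <? β k
      ... | no ¬a | _       = ≤-trans (≤-reflexive (reflexive (gain-inactive ¬a))) (≤-trans 0≤1 1≤1+λ)
      ... | yes a | yes h<β = ≤-reflexive (reflexive (gain-climbing a h<β))
      ... | yes a | no h≮β  = ≤-trans (≤-reflexive (reflexive (gain-settled a h≮β))) 1≤1+λ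

      gain≤1 : ∀ {t k} → ¬ (h t k < β k) → gain h t k ≤ 1#
      gain≤1 {t} {k} h≮β with active? h t k
      ... | no ¬a = ≤-trans (≤-reflexive (reflexive (gain-inactive ¬a))) 0≤1
      ... | yes a = ≤-reflexive (reflexive (gain-settled a h≮β))

      1≤gain : ∀ {t k} → Active h t k → 1# ≤ gain h t k
      1≤gain {t} {k} a with h t k <? β k
      ... | yes h<β = ≤-trans 1≤1+λ (≤-reflexive (reflexive (≡.sym (gain-climbing a h<β))))
      ... | no h≮β  = ≤-reflexive (reflexive (≡.sym (gain-settled a h≮β)))

      -- Rescaling the update by exp (- (η * (1# + λ₀))) does not affect the
      -- projection, and makes all multipliers at most 1.
      multiplier : ℕ → Vector
      multiplier t k = exp (η * gain h t k - η * (1# + λ₀))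

      multiplier≤ : ∀ {t k} g → gain h t k ≤ g → multiplier t k ≤ exp (η * (g - (1# + λ₀)))
      multiplier≤ {t} {k} g gain≤g = exp-mono-≤ (≤-by
        (solve 4 (λ η g g' l → η :* (g' :- l) := η :* g :- η :* l :+ η :* (g' :- g)) refl
          η (gain h t k) g (1# + λ₀))
        (*-nonNeg (proj₁ 0<η) (x≤y⇒0≤y-x gain≤g)))

      multiplier≤1 : ∀ t k → multiplier t k ≤ 1#
      multiplier≤1 t k = begin
        multiplier t k                      ≤⟨ multiplier≤ _ (gain≤1+λ t k) ⟩
        exp (η * (1# + λ₀ - (1# + λ₀)))
          ≈⟨ exp-cong (solve 2 (λ η l → η :* (l :- l) := lit 0) refl η (1# + λ₀)) ⟩
        exp 0#                              ≈⟨ exp-0 ⟩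
        1#                                  ∎

      multiplier≤decay : ∀ {t k} → ¬ (h t k < β k) → multiplier t k ≤ decay
      multiplier≤decay {t} {k} h≮β = begin
        multiplier t k                      ≤⟨ multiplier≤ _ (gain≤1 h≮β) ⟩
        exp (η * (1# - (1# + λ₀)))
          ≈⟨ exp-cong (solve 2 (λ η l → η :* (lit 1 :- (lit 1 :+ l)) := :- (η :* l)) refl η λ₀) ⟩
        decay                               ∎

      decay≤multiplier : ∀ {t k} → Active h t k → decay ≤ multiplier t k
      decay≤multiplier {t} {k} a = exp-mono-≤ (≤-by
        (solve 3 (λ η g l → η :* g :- η :* (lit 1 :+ l) := :- (η :* l) :+ η :* (g :- lit 1)) refl
          η (gain h t k) λ₀)
        (*-nonNeg (proj₁ 0<η) (x≤y⇒0≤y-x (1≤gain a))))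

      multiplier-climbing : ∀ {t k} → Active h t k → h t k < β k → multiplier t k ≈ 1#
      multiplier-climbing {t} {k} a h<β = begin-equality
        multiplier t k
          ≈⟨ exp-cong (+-congʳ (*-congˡ (reflexive (gain-climbing a h<β)))) ⟩
        exp (η * (1# + λ₀) - η * (1# + λ₀))       ≈⟨ exp-cong (-‿inverseʳ _) ⟩
        exp 0#                                    ≈⟨ exp-0 ⟩
        1#                                        ∎

      -- One step of the allocation.

      module _ {t : ℕ} (t<T : suc t ℕ.≤ T) where
        x x⁺ : Vector
        x  = h (suc t)
        x⁺ = h (suc (suc t))

        Σx≈1 : sum x ≈ 1#
        Σx≈1 = proj₁ (allocation∈Δ t (ℕ.<⇒≤ t<T))

        μ≤x : ∀ k → μ ≤ x k
        μ≤x = ε/N≤allocation (ℕ.<⇒≤ t<T)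

        0<x : ∀ k → 0# < x k
        0<x k = <-≤-trans 0<ε/N (μ≤x k)

        -- This is `projection-lower-bound` at ρ = exp(-η(1 + λ)) · κ. The first factor turns the
        -- update into `multiplier`; the free factor κ converts a comparison vector of total below 1
        -- into growth.
        allocation-lower-bound : ∀ {c κ} → 0# < κ →
          (∀ k → μ ≤ c k) → (∀ k → x k * multiplier (suc t) k * κ ≤ c k) → sum c ≤ 1# →
          ∀ i → x i * multiplier (suc t) i * κ ≤ x⁺ i
        allocation-lower-bound {c} {κ} 0<κ μ≤c xmκ≤c Σc≤1 i =
          ≤-trans (≤-reflexive (sym (rescale i)))
            (projection-lower-bound {ε = ε} {c = c} 0<ε/N (λ k → *-pos (0<x k) (exp-pos _))
              (*-pos (exp-pos _) 0<κ) (IsRun.step run (suc t) (ℕ.s≤s ℕ.z≤n) t<T)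
              μ≤c (λ k → ≤-trans (≤-reflexive (rescale k)) (xmκ≤c k)) Σc≤1 i)
          where
          rescale : ∀ k → update h (suc t) k * (exp (- (η * (1# + λ₀))) * κ) ≈ x k * multiplier (suc t) k * κ
          rescale k = trans
            (solve 4 (λ x e f κ → x :* e :* (f :* κ) := x :* (e :* f) :* κ) refl (x k) _ _ κ)
            (*-congʳ (*-congˡ (sym (exp-+ _ _))))

        -- The old allocation itself is the comparison vector: it has total 1 and, as no multiplier
        -- exceeds 1, it dominates the rescaled update.
        allocation-decay : ∀ {i} → Active h (suc t) i → x i * decay ≤ x⁺ i
        allocation-decay {i} a = begin
          x i * decay                     ≤⟨ *-monoˡ-≤ (proj₁ (0<x i)) (decay≤multiplier a) ⟩
          x i * multiplier (suc t) i      ≈⟨ *-identityʳ _ ⟨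
          x i * multiplier (suc t) i * 1#
            ≤⟨ allocation-lower-bound 0<1 μ≤x (λ k → begin
                 x k * multiplier (suc t) k * 1# ≈⟨ *-identityʳ _ ⟩
                 x k * multiplier (suc t) k
                   ≤⟨ *-monoˡ-≤ (proj₁ (0<x k)) (multiplier≤1 (suc t) k) ⟩
                 x k * 1#                        ≈⟨ *-identityʳ _ ⟩
                 x k                             ∎) (≤-reflexive Σx≈1) i ⟩
          x⁺ i                            ∎

        surplus : Vector
        surplus k = 0# ⊔ (x k - β k)

        -- Since Σβ ≤ 1 = Σx, a deficit of user i is matched by surpluses of others.
        deficit≤Σsurplus : ∀ {i} → β i - x i ≤ sum surplus
        deficit≤Σsurplus {i} = begin
          β i - x i
            ≈⟨ solve 2 (λ b x → b :- x := lit 0 :+ (b :- x)) refl (β i) (x i) ⟩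
          0# + (β i - x i)                          ≤⟨ +-mono-≤ (x≤x⊔y _ _) ≤-refl ⟩
          surplus i + (β i - x i)
            ≤⟨ term≤sum {t = λ k → surplus k + (β k - x k)} (λ k → ≤-trans
                 (x≤y⇒0≤y-x (x≤y⊔x 0# (x k - β k)))
                 (≤-reflexive (solve 3 (λ s b x → s :- (x :- b) := s :+ (b :- x)) refl
                    (surplus k) (β k) (x k)))) i ⟩
          sum (λ k → surplus k + (β k - x k))       ≈⟨ ∑-distrib-+ surplus (λ k → β k - x k) ⟩
          sum surplus + sum (λ k → β k - x k)       ≈⟨ +-congˡ (sum-distrib-- β x) ⟩
          sum surplus + (sum β - sum x)             ≈⟨ +-congˡ (+-congˡ (-‿cong Σx≈1)) ⟩
          sum surplus + (sum β - 1#)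
            ≤⟨ ≤-by (solve 2 (λ s b → s := s :+ (b :- lit 1) :+ (lit 1 :- b)) refl (sum surplus) (sum β))
                                                            (x≤y⇒0≤y-x Σβ≤1) ⟩
          sum surplus                               ∎

        -- The comparison vector for growth. It keeps `x k` up to the SLA, and above it equals
        -- `decay` · x + θ · β. This convex combination dominates `x k * decay`, and it respects the
        -- floor because both `x k` and `β k` do; plain `x k * decay` could fall below the floor.
        damped : Vector
        damped k = x k - θ * surplus k

        damped-cases : ∀ k → damped k ≈ x k ⊎ damped k ≈ x k - θ * (x k - β k)
        damped-cases k with ⊔-sel 0# (x k - β k)
        ... | inj₁ s≈0   = inj₁ (trans (+-congˡ (-‿cong (*-congˡ s≈0)))
                                  (solve 2 (λ x θ → x :- θ :* lit 0 := x) refl (x k) θ))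
        ... | inj₂ s≈x-β = inj₂ (+-congˡ (-‿cong (*-congˡ s≈x-β)))

        μ≤damped : ∀ k → μ ≤ damped k
        μ≤damped k with damped-cases k
        ... | inj₁ ≈x = ≤-trans (μ≤x k) (≤-reflexive (sym ≈x))
        ... | inj₂ ≈y = ≤-by (trans ≈y
          (solve 4 (λ x β q μ → x :- (lit 1 :- q) :* (x :- β) :=
                                μ :+ (q :* (x :- μ) :+ (lit 1 :- q) :* (β :- μ))) refl (x k) (β k) decay μ))
          (+-nonNeg (*-nonNeg (proj₁ (exp-pos _)) (x≤y⇒0≤y-x (μ≤x k)))
                    (*-nonNeg 0≤θ (x≤y⇒0≤y-x (ε/N≤β k))))

        x≤damped : ∀ {k} → x k ≤ β k → x k ≤ damped k
        x≤damped {k} x≤β with damped-cases k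
        ... | inj₁ ≈x = ≤-reflexive (sym ≈x)
        ... | inj₂ ≈y = ≤-by (trans ≈y (solve 3 (λ x θ β → x :- θ :* (x :- β) := x :+ θ :* (β :- x)) refl (x k) θ (β k)))
                             (*-nonNeg 0≤θ (x≤y⇒0≤y-x x≤β))

        x*decay≤damped : ∀ k → x k * decay ≤ damped k
        x*decay≤damped k with damped-cases k
        ... | inj₁ ≈x = ≤-by (trans ≈x (solve 2 (λ x q → x := x :* q :+ x :* (lit 1 :- q)) refl (x k) decay))
                             (*-nonNeg (proj₁ (0<x k)) 0≤θ)
        ... | inj₂ ≈y = ≤-by (trans ≈y (solve 3 (λ x q β → x :- (lit 1 :- q) :* (x :- β) :=
                                                           x :* q :+ (lit 1 :- q) :* β) refl (x k) decay (β k)))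
                             (*-nonNeg 0≤θ (proj₁ (0<β k)))

        -- Activity need not be distinguished: an inactive user has gain 0, so its multiplier obeys
        -- the same upper bounds as that of an active one on the same side of its SLA.
        x*multiplier≤damped : ∀ k → x k * multiplier (suc t) k ≤ damped k
        x*multiplier≤damped k with x k <? β k
        ... | yes x<β = begin
          x k * multiplier (suc t) k  ≤⟨ *-monoˡ-≤ (proj₁ (0<x k)) (multiplier≤1 (suc t) k) ⟩
          x k * 1#                    ≈⟨ *-identityʳ _ ⟩
          x k                         ≤⟨ x≤damped (proj₁ x<β) ⟩
          damped k                    ∎
        ... | no x≮β = begin
          x k * multiplier (suc t) k  ≤⟨ *-monoˡ-≤ (proj₁ (0<x k)) (multiplier≤decay x≮β) ⟩
          x k * decay                 ≤⟨ x*decay≤damped k ⟩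
          damped k                    ∎

        Σdamped≤ : ∀ {i} → sum damped ≤ exp (- (θ * (β i - x i)))
        Σdamped≤ {i} = begin
          sum damped                        ≈⟨ sum-distrib-- x (λ k → θ * surplus k) ⟩
          sum x - sum (λ k → θ * surplus k)
            ≈⟨ +-cong Σx≈1 (-‿cong (sym (*-distribˡ-sum θ surplus))) ⟩
          1# - θ * sum surplus
            ≤⟨ ≤-by (solve 3 (λ θ s d → lit 1 :+ :- (θ :* d) := lit 1 :- θ :* s :+ θ :* (s :- d)) refl θ (sum surplus) (β i - x i))
                                                    (*-nonNeg 0≤θ (x≤y⇒0≤y-x deficit≤Σsurplus)) ⟩
          1# + - (θ * (β i - x i))          ≤⟨ 1+x≤exp-x _ ⟩
          exp (- (θ * (β i - x i)))         ∎

        -- The factor κ is the inverse of the bound on the total of `damped`, so κ · `damped` has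
        -- total at most 1; as κ ≥ 1, it still respects the floor. A climbing user has multiplier
        -- exactly 1 and therefore receives all of κ.
        allocation-growth : ∀ {i} → Active h (suc t) i → x i < β i →
                            x i * exp (θ * (β i - x i)) ≤ x⁺ i
        allocation-growth {i} a x<β = begin
          x i * κ                           ≈⟨ *-congʳ (*-identityʳ _) ⟨
          x i * 1# * κ                      ≈⟨ *-congʳ (*-congˡ (multiplier-climbing a x<β)) ⟨
          x i * multiplier (suc t) i * κ
            ≤⟨ allocation-lower-bound {c = λ k → κ * damped k} (exp-pos _)
                 (λ k → begin
                    μ            ≈⟨ *-identityˡ _ ⟨
                    1# * μ
                      ≤⟨ *-mono-≤ 0≤1 (≤-trans (proj₁ 0<ε/N) (μ≤damped k)) (1≤exp (*-nonNeg 0≤θ (x≤y⇒0≤y-x (proj₁ x<β)))) (μ≤damped k) ⟩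
                    κ * damped k ∎)
                 (λ k → ≤-trans (≤-reflexive (*-comm _ _)) (*-monoˡ-≤ (proj₁ (exp-pos _)) (x*multiplier≤damped k)))
                 (begin
                    sum (λ k → κ * damped k)              ≈⟨ *-distribˡ-sum κ damped ⟨
                    κ * sum damped
                      ≤⟨ *-monoˡ-≤ (proj₁ (exp-pos _)) Σdamped≤ ⟩
                    κ * exp (- (θ * (β i - x i)))         ≈⟨ trans (*-comm _ _) (exp-inverseˡ _) ⟩
                    1#                                    ∎) i ⟩
          x⁺ i                              ∎
          where
          κ : Carrier
          κ = exp (θ * (β i - x i))

      -- Busy periods of one user, and the comparison of its queues.

      module _
        {h' : Sequence} {i : User} (h'≤β : ∀ t → 1 ℕ.≤ t → t ℕ.≤ T → h' t i ≤ β i)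
        {M : Carrier} (1≤μexpθM : 1# ≤ μ * exp (θ * M))
        where

        excess : ℕ → Carrier → Set
        excess t D = queue L h t i ≤ queue L h' t i + D

        -- While a backlogged user has not reached its SLA, the growth of its
        -- allocation pays for the accumulated deficit P.
        Climbing : ℕ → Set
        Climbing t = ∃ λ P → excess t (1# + P) × μ * exp (θ * P) ≤ h t i

        -- The excess charges θ for every time since the start, so the moment of settling need not
        -- be recorded. The allocation is only required to be at least β · `decay`, since one step
        -- from above the SLA may lose that factor.
        Settled : ℕ → Set
        Settled t = excess t (1# + M + fromℕ t * θ) × β i * decay ≤ h t i

        -- An allocation is at most 1, which caps the potential. `M` stands for any upper bound of
        -- log(N/ε)/θ.
        P≤M : ∀ {t P} → t ℕ.≤ T → μ * exp (θ * P) ≤ h (suc t) i → P ≤ M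
        P≤M {t} {P} t≤T μeP≤h = *-cancelˡ-≤ 0<θ (exp-cancel-≤ (*-cancelˡ-≤ 0<ε/N (begin
          μ * exp (θ * P) ≤⟨ μeP≤h ⟩
          h (suc t) i     ≤⟨ allocation≤1 t≤T i ⟩
          1#              ≤⟨ 1≤μexpθM ⟩
          μ * exp (θ * M) ∎)))

        module _ {t : ℕ} (t<T : suc t ℕ.≤ T) (a⁺ : Active h (suc (suc t)) i) where
          hᵢ δ : Carrier
          hᵢ = h (suc t) i
          δ  = β i - hᵢ

          t≤T : t ℕ.≤ T
          t≤T = ℕ.<⇒≤ t<T

          excess-next : ∀ {D D'} → D + δ ≤ D' → excess (suc t) D → excess (suc (suc t)) D'
          excess-next D+δ≤D' Q≤ =
            ≤-trans (excess-step L h h' t i a⁺ (h'≤β (suc t) (ℕ.s≤s ℕ.z≤n) t<T) Q≤) (+-monoʳ-≤ _ D+δ≤D')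

          -- The slot that opens a busy period may leave a deficit β - h ≤ 1 without any growth of
          -- the allocation in return; this is the `1#` in `Climbing`. The potential then starts
          -- afresh from the floor `μ`, with P = 0.
          inactive⇒climbing : ¬ Active h (suc t) i → Climbing (suc (suc t))
          inactive⇒climbing ¬a = 0#
            , excess-next
                (≤-by (solve 2 (λ β x → lit 1 :+ lit 0 :=
                                        lit 0 :+ (β :- x) :+ (lit 1 :- β :+ x)) refl (β i) hᵢ)
                      (+-nonNeg (x≤y⇒0≤y-x (β≤1 i)) (0≤allocation t≤T i)))
                (≤-trans (≮⇒≥ ¬a) (+-nonNeg (queue-nonNeg L h' (suc t) i) ≤-refl))
            , (begin
                μ * exp (θ * 0#)  ≈⟨ *-congˡ (trans (exp-cong (zeroʳ θ)) exp-0) ⟩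
                μ * 1#            ≈⟨ *-identityʳ μ ⟩
                μ                 ≤⟨ ε/N≤allocation t<T i ⟩
                h (suc (suc t)) i ∎)

          climbing⇒climbing : Active h (suc t) i → hᵢ < β i → Climbing (suc t) → Climbing (suc (suc t))
          climbing⇒climbing a h<β (P , Q≤ , μeP≤h) = P + δ
            , excess-next (≤-reflexive (solve 3 (λ o p d → o :+ p :+ d := o :+ (p :+ d)) refl 1# P δ)) Q≤
            , (begin
                μ * exp (θ * (P + δ))
                  ≈⟨ *-congˡ (exp-cong (solve 3 (λ θ p d → θ :* (p :+ d) := θ :* p :+ θ :* d) refl θ P δ)) ⟩
                μ * exp (θ * P + θ * δ)           ≈⟨ *-congˡ (exp-+ _ _) ⟩
                μ * (exp (θ * P) * exp (θ * δ))   ≈⟨ *-assoc _ _ _ ⟨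
                μ * exp (θ * P) * exp (θ * δ)     ≤⟨ *-monoʳ-≤ (proj₁ (exp-pos _)) μeP≤h ⟩
                hᵢ * exp (θ * δ)                  ≤⟨ allocation-growth t<T a h<β ⟩
                h (suc (suc t)) i                 ∎)

          stays-settled : Active h (suc t) i → β i ≤ hᵢ → β i * decay ≤ h (suc (suc t)) i
          stays-settled a β≤h = ≤-trans (*-monoʳ-≤ (proj₁ (exp-pos _)) β≤h) (allocation-decay t<T a)

          climbing⇒settled : Active h (suc t) i → β i ≤ hᵢ → Climbing (suc t) → Settled (suc (suc t))
          climbing⇒settled a β≤h (P , Q≤ , μeP≤h) =
            excess-next
              (≤-by (solve 5 (λ m p h b n → lit 1 :+ m :+ n := lit 1 :+ p :+ (b :- h) :+ (m :- p :+ (h :- b) :+ n))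
                       refl M P hᵢ (β i) (fromℕ (suc (suc t)) * θ))
                    (+-nonNeg (+-nonNeg (x≤y⇒0≤y-x (P≤M t≤T μeP≤h)) (x≤y⇒0≤y-x β≤h))
                              (*-nonNeg (fromℕ-nonNeg (suc (suc t))) 0≤θ))) Q≤
            , stays-settled a β≤h

          settled⇒settled : Active h (suc t) i → Settled (suc t) → Settled (suc (suc t))
          settled⇒settled a (Q≤ , βq≤h) =
            excess-next
              -- The new deficit is at most β(1 - `decay`) = βθ ≤ θ, because β ≤ 1.
              (≤-by (solve 5 (λ m b h n q → lit 1 :+ m :+ (lit 1 :+ n) :* (lit 1 :- q) :=
                                lit 1 :+ m :+ n :* (lit 1 :- q) :+ (b :- h) :+
                                (h :- b :* q :+ (lit 1 :- q) :* (lit 1 :- b)))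
                       refl M (β i) hᵢ (fromℕ (suc t)) decay)
                    (+-nonNeg (x≤y⇒0≤y-x βq≤h) (*-nonNeg 0≤θ (x≤y⇒0≤y-x (β≤1 i))))) Q≤
            , βq≤h⁺
            where
            βq≤h⁺ : β i * decay ≤ h (suc (suc t)) i
            -- The losses do not accumulate: a factor `decay` is lost only from at or above the SLA,
            -- and below it an active user's allocation cannot decrease.
            βq≤h⁺ with hᵢ <? β i
            ... | no h≮β  = stays-settled a (≮⇒≥ h≮β)
            ... | yes h<β = begin
              β i * decay       ≤⟨ βq≤h ⟩
              hᵢ                ≈⟨ *-identityʳ hᵢ ⟨
              hᵢ * 1#
                ≤⟨ *-monoˡ-≤ (0≤allocation t≤T i) (1≤exp (*-nonNeg 0≤θ (x≤y⇒0≤y-x (proj₁ h<β)))) ⟩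
              hᵢ * exp (θ * δ)  ≤⟨ allocation-growth t<T a h<β ⟩
              h (suc (suc t)) i ∎

        phase : ∀ t → suc t ℕ.≤ T → Active h (suc t) i → Climbing (suc t) ⊎ Settled (suc t)
        -- The queue at time 1 is 0, so every busy period is preceded by an inactive slot.
        phase zero    _      0<0 = contradiction ≤-refl (<⇒≱ 0<0)
        phase (suc t) 1+t<T a⁺ with active? h (suc t) i
        ... | no ¬a = inj₁ (inactive⇒climbing (ℕ.<⇒≤ 1+t<T) a⁺ ¬a)
        ... | yes a with phase t (ℕ.<⇒≤ 1+t<T) a | h (suc t) i <? β i
        ...   | inj₁ climbing | yes h<β = inj₁ (climbing⇒climbing (ℕ.<⇒≤ 1+t<T) a⁺ a h<β climbing)
        ...   | inj₁ climbing | no h≮β  = inj₂ (climbing⇒settled (ℕ.<⇒≤ 1+t<T) a⁺ a (≮⇒≥ h≮β) climbing)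
        -- A settled user that drops below its SLA again does not return to climbing, so `M` is paid
        -- only once per busy period.
        ...   | inj₂ settled  | _       = inj₂ (settled⇒settled (ℕ.<⇒≤ 1+t<T) a⁺ a settled)

        excess-weaken : ∀ {t D D'} → D ≤ D' → excess t D → excess t D'
        excess-weaken D≤D' Q≤ = ≤-trans Q≤ (+-monoʳ-≤ _ D≤D')

        queue-bound : 0# ≤ M → ∀ t → suc t ℕ.≤ T → excess (suc t) (1# + M + fromℕ (suc t) * θ)
        queue-bound 0≤M t t<T with active? h (suc t) i
        ... | no ¬a = ≤-trans (≮⇒≥ ¬a) (+-nonNeg (queue-nonNeg L h' (suc t) i)
                        (+-nonNeg (+-nonNeg 0≤1 0≤M) (*-nonNeg (fromℕ-nonNeg (suc t)) 0≤θ)))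
        ... | yes a with phase t t<T a
        ...   | inj₁ (P , Q≤ , μeP≤h) = excess-weaken {suc t} {1# + P} {1# + M + fromℕ (suc t) * θ}
                  (≤-by (solve 3 (λ m p n → lit 1 :+ m :+ n := lit 1 :+ p :+ (m :- p :+ n)) refl M P (fromℕ (suc t) * θ))
                    (+-nonNeg (x≤y⇒0≤y-x (P≤M (ℕ.<⇒≤ t<T) μeP≤h)) (*-nonNeg (fromℕ-nonNeg (suc t)) 0≤θ))) Q≤
        ...   | inj₂ (Q≤ , _) = Q≤

-- Real powers, logarithms and the final constant.

module Estimates (ℝ : RealNumbers) where
  open RealProperties ℝ
  open ≤-Reasoning

  1/[1+n]≤1 : ∀ n → fromℕ 1 / fromℕ (suc n) ≤ 1#
  1/[1+n]≤1 n = *-cancelˡ-≤ (fromℕ-pos n) (begin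
    fromℕ (suc n) * (fromℕ 1 / fromℕ (suc n)) ≈⟨ *-/-cancel (fromℕ-pos n) _ ⟩
    fromℕ 1                                   ≤⟨ fromℕ-mono {1} {suc n} (ℕ.s≤s ℕ.z≤n) ⟩
    fromℕ (suc n)                             ≈⟨ *-identityʳ _ ⟨
    fromℕ (suc n) * 1#                        ∎)

  0≤log : ∀ {x} → 1# ≤ x → 0# ≤ log x
  0≤log {x} 1≤x = exp-cancel-≤ (begin
    exp 0#      ≈⟨ exp-0 ⟩
    1#          ≤⟨ 1≤x ⟩
    x           ≈⟨ exp-log-pos (<-≤-trans 0<1 1≤x) ⟨
    exp (log x) ∎)

  1≤^ : ∀ {x p} → 1# ≤ x → 0# ≤ p → 1# ≤ x ^ p
  1≤^ 1≤x 0≤p = 1≤exp (*-nonNeg 0≤p (0≤log 1≤x))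

  ^-+ : ∀ x p q → x ^ p * x ^ q ≈ x ^ (p + q)
  ^-+ x p q = trans (sym (exp-+ _ _))
    (exp-cong (solve 3 (λ p q l → p :* l :+ q :* l := (p :+ q) :* l) refl p q (log x)))

  ^-cong : ∀ x {p q} → p ≈ q → x ^ p ≈ x ^ q
  ^-cong x p≈q = exp-cong (*-congʳ p≈q)

  ^-1 : ∀ {x} → 0# < x → x ^ 1# ≈ x
  ^-1 0<x = trans (exp-cong (*-identityˡ _)) (exp-log-pos 0<x)

  1/_ : ℕ → Carrier
  1/ n = fromℕ 1 / fromℕ n

  1/-pos : ∀ n → 0# < 1/ (suc n)
  1/-pos n = /-pos (fromℕ-pos 0) (fromℕ-pos n)

  cube-root : ∀ {x} → 0# < x → x ^ (1/ 3) * x ^ (1/ 3) * x ^ (1/ 3) ≈ x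
  cube-root {x} 0<x = begin-equality
    x ^ (1/ 3) * x ^ (1/ 3) * x ^ (1/ 3) ≈⟨ trans (*-congʳ (^-+ x _ _)) (^-+ x _ _) ⟩
    x ^ (1/ 3 + 1/ 3 + 1/ 3)             ≈⟨ ^-cong x (trans
      (solve 1 (λ i → one :* i :+ one :* i :+ one :* i := lit 3 :* i) refl (fromℕ 3 ⁻¹))
      (⁻¹-inverseʳ (pos⇒≉0 (fromℕ-pos 2)))) ⟩
    x ^ 1#                               ≈⟨ ^-1 0<x ⟩
    x                                    ∎
    where
    one : ∀ {n} → Polynomial n
    -- `fromℕ 1` unfolds to `1# + 0#`, and the polynomial has to have the same shape.
    one = lit 1 :+ lit 0

  fourth-root³ : ∀ x → x ^ (1/ 4) * x ^ (1/ 4) * x ^ (1/ 4) ≈ x ^ (fromℕ 3 / fromℕ 4)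
  fourth-root³ x = trans (trans (*-congʳ (^-+ x _ _)) (^-+ x _ _)) (^-cong x
    (solve 1 (λ i → one :* i :+ one :* i :+ one :* i := lit 3 :* i) refl (fromℕ 4 ⁻¹)))
    where
    one : ∀ {n} → Polynomial n
    one = lit 1 :+ lit 0

  fourth-root⁴ : ∀ {x} → 0# < x → x ^ (1/ 4) * x ^ (1/ 4) * x ^ (1/ 4) * x ^ (1/ 4) ≈ x
  fourth-root⁴ {x} 0<x = begin-equality
    x ^ (1/ 4) * x ^ (1/ 4) * x ^ (1/ 4) * x ^ (1/ 4)
      ≈⟨ trans (*-congʳ (fourth-root³ x)) (^-+ x _ _) ⟩
    x ^ (fromℕ 3 / fromℕ 4 + 1/ 4)        ≈⟨ ^-cong x (trans
      (solve 1 (λ i → lit 3 :* i :+ (lit 1 :+ lit 0) :* i := lit 4 :* i) refl (fromℕ 4 ⁻¹))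
      (⁻¹-inverseʳ (pos⇒≉0 (fromℕ-pos 3)))) ⟩
    x ^ 1#                               ≈⟨ ^-1 0<x ⟩
    x                                    ∎

  -- Inverting 1 - 1/2 ≤ exp(-1/2) gives exp(1/2) ≤ 2. The bound lets log(NT) absorb additive
  -- constants.
  1/2≤log : ∀ {x} → fromℕ 2 ≤ x → 1/2 ≤ log x
  1/2≤log {x} 2≤x = exp-cancel-≤ (begin
    exp 1/2     ≤⟨ *-cancelˡ-≤ (⁻¹-pos (fromℕ-pos 1)) (begin
      1/2 * exp 1/2       ≈⟨ *-congʳ (trans (solve 1 (λ h → h := h :+ h :- h) refl 1/2)
                               (+-congʳ (trans (solve 1 (λ h → h :+ h := lit 2 :* h) refl 1/2) 2*1/2≈1))) ⟩
      (1# - 1/2) * exp 1/2 ≤⟨ *-monoʳ-≤ (proj₁ (exp-pos _)) (1+x≤exp-x (- 1/2)) ⟩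
      exp (- 1/2) * exp 1/2 ≈⟨ exp-inverseˡ 1/2 ⟩
      1#                  ≈⟨ trans (*-comm _ _) 2*1/2≈1 ⟨
      1/2 * fromℕ 2       ∎) ⟩
    fromℕ 2     ≤⟨ 2≤x ⟩
    x           ≈⟨ exp-log-pos (<-≤-trans (fromℕ-pos 1) 2≤x) ⟨
    exp (log x) ∎)
    where
    2*1/2≈1 : fromℕ 2 * 1/2 ≈ 1#
    2*1/2≈1 = ⁻¹-inverseʳ (pos⇒≉0 (fromℕ-pos 1))

  -- From exp(-x) ≤ 1/(1 + x) one gets 1 - exp(-x) ≥ x/(1 + x) ≥ x/2; multiplying through by 1 + x
  -- avoids the division.
  x≤2[1-exp[-x]] : ∀ {x} → 0# ≤ x → x ≤ 1# → x ≤ fromℕ 2 * (1# - exp (- x))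
  x≤2[1-exp[-x]] {x} 0≤x x≤1 = *-cancelˡ-≤ (+-pos 0<1 0≤x) (≤-by
    (solve 2 (λ x e → (lit 1 :+ x) :* (lit 2 :* (lit 1 :- e)) :=
       (lit 1 :+ x) :* x :+ (x :* (lit 1 :- x) :+ lit 2 :* (lit 1 :- e :* (lit 1 :+ x))))
       refl x (exp (- x)))
    (+-nonNeg (*-nonNeg 0≤x (x≤y⇒0≤y-x x≤1)) (*-nonNeg (fromℕ-nonNeg 2) (x≤y⇒0≤y-x (begin
       exp (- x) * (1# + x) ≤⟨ *-monoˡ-≤ (proj₁ (exp-pos _)) (1+x≤exp-x x) ⟩
       exp (- x) * exp x    ≈⟨ exp-inverseˡ x ⟩
       1#                   ∎)))))

  1-exp[-x]≤x : ∀ x → 1# - exp (- x) ≤ x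
  1-exp[-x]≤x x = ≤-by (solve 2 (λ x e → x := lit 1 :- e :+ (e :- (lit 1 :+ :- x))) refl x (exp (- x)))
    (x≤y⇒0≤y-x (1+x≤exp-x (- x)))

  1≤x⇒y≤x*y : ∀ {x y} → 1# ≤ x → 0# ≤ y → y ≤ x * y
  1≤x⇒y≤x*y 1≤x 0≤y = ≤-trans (≤-reflexive (sym (*-identityˡ _))) (*-monoʳ-≤ 0≤y 1≤x)

  -- The 16 is the 8 of `λ₀` times the 2 lost in θ ≥ ηλ/2, the denominator comes from ε ≥ a/T^(1/4),
  -- and 1 + 2/a bounds (log(NT) + 1/a)/log(NT).
  climbConstant : (η a : Carrier) → Carrier
  climbConstant η a = fromℕ 16 * (1# + fromℕ 2 * a ⁻¹) / (η * (a * a))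

  -- The summands pay, in this order, for the opening slot, the climb and the settled steps.
  constant : (η a b : Carrier) → Carrier
  constant η a b = fromℕ 2 + climbConstant η a + fromℕ 2 * (b * b)

  0<climbConstant : ∀ {η a} → 0# < η → 0# < a → 0# < climbConstant η a
  0<climbConstant 0<η 0<a =
    /-pos (*-pos (fromℕ-pos 15) (+-pos 0<1 (*-nonNeg (fromℕ-nonNeg 2) (proj₁ (⁻¹-pos 0<a)))))
          (*-pos 0<η (*-pos 0<a 0<a))

  0<constant : ∀ {η a b} → 0# < η → 0# < a → 0# < constant η a b
  0<constant {η} {a} {b} 0<η 0<a =
    +-pos (+-pos (fromℕ-pos 1) (proj₁ (0<climbConstant 0<η 0<a)))
          (*-nonNeg (fromℕ-nonNeg 2) (0≤x*x b))

  module Parameters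
    {η a b ε : Carrier} {N T : ℕ} (0<η : 0# < η) (η≤1 : η ≤ 1#) (0<a : 0# < a)
    (2≤N : 2 ℕ.≤ N) (1≤T : 1 ℕ.≤ T)
    (ε-lower : a * (fromℕ N ^ (1/ 3) / fromℕ T ^ (1/ 4)) ≤ ε)
    (ε-upper : ε ≤ b * (fromℕ N ^ (1/ 3) / fromℕ T ^ (1/ 4)))
    (ε≤1 : ε ≤ 1#)
    where

    n τ u v Λ W λ₀ θ K M : Carrier
    n  = fromℕ N
    τ  = fromℕ T
    u  = n ^ (1/ 3)
    v  = τ ^ (1/ 4)
    Λ  = log (n * τ)
    W  = n * (v * v * v) * Λ
    λ₀ = (ε * ε) / (fromℕ 8 * n)
    θ  = 1# - exp (- (η * λ₀))
    K  = climbConstant η a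
    M  = K * W

    2≤n : fromℕ 2 ≤ n
    2≤n = fromℕ-mono 2≤N

    1≤n : 1# ≤ n
    1≤n = 1≤fromℕ (ℕ.≤-trans (ℕ.s≤s ℕ.z≤n) 2≤N)

    1≤τ : 1# ≤ τ
    1≤τ = 1≤fromℕ 1≤T

    0<n : 0# < n
    0<n = <-≤-trans 0<1 1≤n

    0<τ : 0# < τ
    0<τ = <-≤-trans 0<1 1≤τ

    1≤u : 1# ≤ u
    1≤u = 1≤^ 1≤n (proj₁ (1/-pos 2))

    1≤v : 1# ≤ v
    1≤v = 1≤^ 1≤τ (proj₁ (1/-pos 3))

    0<v : 0# < v
    0<v = <-≤-trans 0<1 1≤v

    0≤u : 0# ≤ u
    0≤u = ≤-trans 0≤1 1≤u

    0≤v : 0# ≤ v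
    0≤v = proj₁ 0<v

    1/2≤Λ : 1/2 ≤ Λ
    1/2≤Λ = 1/2≤log (begin
      fromℕ 2 ≤⟨ 2≤n ⟩
      n       ≤⟨ 1≤x⇒y≤x*y 1≤τ (proj₁ 0<n) ⟩
      τ * n   ≈⟨ *-comm _ _ ⟩
      n * τ   ∎)

    1≤2Λ : 1# ≤ fromℕ 2 * Λ
    1≤2Λ = ≤-trans (≤-reflexive (sym (⁻¹-inverseʳ (pos⇒≉0 (fromℕ-pos 1)))))
                   (*-monoˡ-≤ (fromℕ-nonNeg 2) 1/2≤Λ)

    0≤Λ : 0# ≤ Λ
    0≤Λ = ≤-trans (proj₁ (⁻¹-pos (fromℕ-pos 1))) 1/2≤Λ

    clear-v : ∀ c → v * (c * (u / v)) ≈ c * u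
    clear-v c = trans (solve 3 (λ v c w → v :* (c :* w) := c :* (v :* w)) refl v c (u / v))
                      (*-congˡ (*-/-cancel 0<v u))

    a≤εv : a ≤ ε * v
    a≤εv = begin
      a                 ≤⟨ 1≤x⇒y≤x*y 1≤u (proj₁ 0<a) ⟩
      u * a             ≈⟨ *-comm u a ⟩
      a * u             ≈⟨ clear-v a ⟨
      v * (a * (u / v)) ≤⟨ *-monoˡ-≤ 0≤v ε-lower ⟩
      v * ε             ≈⟨ *-comm v ε ⟩
      ε * v             ∎

    εv≤bu : ε * v ≤ b * u
    εv≤bu = begin
      ε * v             ≈⟨ *-comm ε v ⟩
      v * ε             ≤⟨ *-monoˡ-≤ 0≤v ε-upper ⟩
      v * (b * (u / v)) ≈⟨ clear-v b ⟩
      b * u             ∎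

    0<εv : 0# < ε * v
    0<εv = <-≤-trans 0<a a≤εv

    0<ε : 0# < ε
    0<ε = *-cancelˡ-< 0≤v (begin-strict
      v * 0# ≈⟨ zeroʳ v ⟩
      0#     <⟨ 0<εv ⟩
      ε * v  ≈⟨ *-comm ε v ⟩
      v * ε  ∎)

    a²≤[εv]² : a * a ≤ ε * v * (ε * v)
    a²≤[εv]² = *-mono-≤ (proj₁ 0<a) (proj₁ 0<εv) a≤εv a≤εv

    -- Since u ≥ 1, u² ≤ u³ = n; the factor `n` later cancels the denominator of `λ₀`.
    [εv]²≤b²n : ε * v * (ε * v) ≤ b * b * n
    [εv]²≤b²n = begin
      ε * v * (ε * v)     ≤⟨ *-mono-≤ (proj₁ 0<εv) (≤-trans (proj₁ 0<εv) εv≤bu) εv≤bu εv≤bu ⟩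
      b * u * (b * u)     ≈⟨ solve 2 (λ b u → b :* u :* (b :* u) := b :* b :* (u :* u)) refl b u ⟩
      b * b * (u * u)     ≤⟨ *-monoˡ-≤ 0≤b² (1≤x⇒y≤x*y 1≤u (*-nonNeg 0≤u 0≤u)) ⟩
      b * b * (u * (u * u)) ≈⟨ *-congˡ (trans (*-comm _ _) (cube-root 0<n)) ⟩
      b * b * n           ∎
      where
      0≤b² : 0# ≤ b * b
      0≤b² = 0≤x*x b

    8nλ≈ε² : fromℕ 8 * n * λ₀ ≈ ε * ε
    8nλ≈ε² = *-/-cancel (*-pos (fromℕ-pos 7) 0<n) (ε * ε)

    0<λ : 0# < λ₀
    0<λ = /-pos (*-pos 0<ε 0<ε) (*-pos (fromℕ-pos 7) 0<n)

    λ≤1 : λ₀ ≤ 1#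
    λ≤1 = *-cancelˡ-≤ (*-pos (fromℕ-pos 7) 0<n) (begin
      fromℕ 8 * n * λ₀ ≈⟨ 8nλ≈ε² ⟩
      ε * ε            ≤⟨ *-mono-≤ (proj₁ 0<ε) 0≤1 ε≤1 ε≤1 ⟩
      1# * 1#          ≤⟨ *-mono-≤ 0≤1 (proj₁ 0<n) (1≤fromℕ {8} (ℕ.s≤s ℕ.z≤n)) 1≤n ⟩
      fromℕ 8 * n      ≈⟨ *-identityʳ _ ⟨
      fromℕ 8 * n * 1# ∎)

    ηλ≤λ : η * λ₀ ≤ λ₀
    ηλ≤λ = ≤-trans (*-monoʳ-≤ (proj₁ 0<λ) η≤1) (≤-reflexive (*-identityˡ λ₀))

    0≤ηλ : 0# ≤ η * λ₀
    0≤ηλ = proj₁ (*-pos 0<η 0<λ)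

    ηε²≤16nθ : η * (ε * ε) ≤ fromℕ 16 * (n * θ)
    ηε²≤16nθ = begin
      η * (ε * ε)                 ≈⟨ *-congˡ 8nλ≈ε² ⟨
      η * (fromℕ 8 * n * λ₀)
        ≈⟨ solve 3 (λ η n l → η :* (lit 8 :* n :* l) := lit 8 :* n :* (η :* l)) refl η n λ₀ ⟩
      fromℕ 8 * n * (η * λ₀)
        ≤⟨ *-monoˡ-≤ (proj₁ (*-pos (fromℕ-pos 7) 0<n)) (x≤2[1-exp[-x]] 0≤ηλ (≤-trans ηλ≤λ λ≤1)) ⟩
      fromℕ 8 * n * (fromℕ 2 * θ)
        ≈⟨ solve 2 (λ n t → lit 8 :* n :* (lit 2 :* t) := lit 16 :* (n :* t)) refl n θ ⟩
      fromℕ 16 * (n * θ)          ∎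

    0≤KΛ : 0# ≤ K * Λ
    0≤KΛ = *-nonNeg (proj₁ (0<climbConstant 0<η 0<a)) 0≤Λ

    0≤W : 0# ≤ W
    0≤W = *-nonNeg (*-nonNeg (proj₁ 0<n) (*-nonNeg (*-nonNeg 0≤v 0≤v) 0≤v)) 0≤Λ

    0≤M : 0# ≤ M
    0≤M = *-nonNeg (proj₁ (0<climbConstant 0<η 0<a)) 0≤W

    -- The left side is an upper bound of log(N/ε): from εT ≥ a it follows that N/ε ≤ NT/a, and
    -- log(1/a) ≤ 1/a.
    Λ+1/a≤θM : Λ + a ⁻¹ ≤ θ * M
    Λ+1/a≤θM = *-cancelˡ-≤ (fromℕ-pos 15) (begin
      fromℕ 16 * (Λ + a ⁻¹)
        ≤⟨ ≤-by (solve 2 (λ l i → lit 16 :* ((lit 1 :+ lit 2 :* i) :* l) :=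
                                  lit 16 :* (l :+ i) :+ lit 16 :* (i :* (lit 2 :* l :- lit 1))) refl Λ (a ⁻¹))
                (*-nonNeg (fromℕ-nonNeg 16) (*-nonNeg (proj₁ (⁻¹-pos 0<a)) (x≤y⇒0≤y-x 1≤2Λ))) ⟩
      fromℕ 16 * ((1# + fromℕ 2 * a ⁻¹) * Λ)
        ≈⟨ trans (*-congʳ (*-/-cancel (*-pos 0<η (*-pos 0<a 0<a)) _)) (*-assoc _ _ _) ⟨
      η * (a * a) * K * Λ
        ≈⟨ solve 4 (λ η a k l → η :* (a :* a) :* k :* l := η :* (k :* l) :* (a :* a)) refl η a K Λ ⟩
      η * (K * Λ) * (a * a)
        ≤⟨ *-monoˡ-≤ 0≤ηKΛ a²≤[εv]² ⟩
      η * (K * Λ) * (ε * v * (ε * v))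
        -- The estimate closes already with v²; the extra factor matches the v³ = T^(3/4) in `W`.
        ≤⟨ 1≤x⇒y≤x*y 1≤v (*-nonNeg 0≤ηKΛ (*-nonNeg (proj₁ 0<εv) (proj₁ 0<εv))) ⟩
      v * (η * (K * Λ) * (ε * v * (ε * v)))
        ≈⟨ solve 4 (λ v η x ε → v :* (η :* x :* (ε :* v :* (ε :* v))) := (η :* (ε :* ε)) :* (x :* (v :* v :* v))) refl v η (K * Λ) ε ⟩
      η * (ε * ε) * (K * Λ * (v * v * v))
        ≤⟨ *-monoʳ-≤ (*-nonNeg 0≤KΛ (*-nonNeg (*-nonNeg 0≤v 0≤v) 0≤v)) ηε²≤16nθ ⟩
      fromℕ 16 * (n * θ) * (K * Λ * (v * v * v))
        ≈⟨ solve 5 (λ n t k l w → lit 16 :* (n :* t) :* (k :* l :* w) := lit 16 :* (t :* (k :* (n :* w :* l))))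
             refl n θ K Λ (v * v * v) ⟩
      fromℕ 16 * (θ * M) ∎)
      where
      0≤ηKΛ : 0# ≤ η * (K * Λ)
      0≤ηKΛ = *-nonNeg (proj₁ 0<η) 0≤KΛ

    v≤τ : v ≤ τ
    v≤τ = ≤-trans (1≤x⇒y≤x*y (*-1≤ (*-1≤ 1≤v 1≤v) 1≤v) 0≤v) (≤-reflexive (fourth-root⁴ 0<τ))
      where
      *-1≤ : ∀ {x y} → 1# ≤ x → 1# ≤ y → 1# ≤ x * y
      *-1≤ 1≤x 1≤y = ≤-trans 1≤y (1≤x⇒y≤x*y 1≤x (≤-trans 0≤1 1≤y))

    1≤ε/n*exp[θM] : 1# ≤ ε / n * exp (θ * M)
    1≤ε/n*exp[θM] = begin
      1#                                  ≈⟨ ⁻¹-inverseʳ (pos⇒≉0 0<a) ⟨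
      a * a ⁻¹                            ≤⟨ *-mono-≤ (proj₁ 0<a) (proj₁ (exp-pos _))
                                               (≤-trans a≤εv (*-monoˡ-≤ (proj₁ 0<ε) v≤τ))
                                               (≤-trans (≤-by (+-comm _ _) 0≤1) (1+x≤exp-x (a ⁻¹))) ⟩
      ε * τ * exp (a ⁻¹)                  ≈⟨ *-congʳ (*-congʳ (*-/-cancel 0<n ε)) ⟨
      n * (ε / n) * τ * exp (a ⁻¹)
        ≈⟨ solve 4 (λ n e t x → n :* e :* t :* x := e :* (n :* t :* x)) refl n (ε / n) τ (exp (a ⁻¹)) ⟩
      ε / n * (n * τ * exp (a ⁻¹))
        ≈⟨ *-congˡ (trans (exp-+ _ _) (*-congʳ (exp-log-pos (*-pos 0<n 0<τ)))) ⟨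
      ε / n * exp (Λ + a ⁻¹)
        ≤⟨ *-monoˡ-≤ (proj₁ (/-pos 0<ε 0<n)) (exp-mono-≤ Λ+1/a≤θM) ⟩
      ε / n * exp (θ * M)                 ∎

    -- Writing τ as v⁴ gives ε²τ = (εv)²v², to which the upper bound on ε applies.
    τλ≤b²v² : τ * λ₀ ≤ b * b * (v * v)
    τλ≤b²v² = *-cancelˡ-≤ (*-pos (fromℕ-pos 7) 0<n) (begin
      fromℕ 8 * n * (τ * λ₀)
        ≈⟨ solve 3 (λ n t l → n :* (t :* l) := n :* l :* t) refl (fromℕ 8 * n) τ λ₀ ⟩
      fromℕ 8 * n * λ₀ * τ              ≈⟨ *-cong 8nλ≈ε² (sym (fourth-root⁴ 0<τ)) ⟩
      ε * ε * (v * v * v * v)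
        ≈⟨ solve 2 (λ ε v → ε :* ε :* (v :* v :* v :* v) := ε :* v :* (ε :* v) :* (v :* v)) refl ε v ⟩
      ε * v * (ε * v) * (v * v)         ≤⟨ *-monoʳ-≤ (*-nonNeg 0≤v 0≤v) [εv]²≤b²n ⟩
      b * b * n * (v * v)
        ≤⟨ 1≤x⇒y≤x*y (1≤fromℕ {8} (ℕ.s≤s ℕ.z≤n)) (*-nonNeg (*-nonNeg (0≤x*x b) (proj₁ 0<n)) (*-nonNeg 0≤v 0≤v)) ⟩
      fromℕ 8 * (b * b * n * (v * v))
        ≈⟨ solve 4 (λ e b n v → e :* (b :* b :* n :* (v :* v)) := e :* n :* (b :* b :* (v :* v))) refl (fromℕ 8) b n v ⟩
      fromℕ 8 * n * (b * b * (v * v))   ∎)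

    v²≤2W : v * v ≤ fromℕ 2 * W
    v²≤2W = begin
      v * v                             ≤⟨ 1≤x⇒y≤x*y 1≤v (*-nonNeg 0≤v 0≤v) ⟩
      v * (v * v)                       ≤⟨ 1≤x⇒y≤x*y 1≤n (*-nonNeg 0≤v (*-nonNeg 0≤v 0≤v)) ⟩
      n * (v * (v * v))
        ≤⟨ 1≤x⇒y≤x*y 1≤2Λ (*-nonNeg (proj₁ 0<n) (*-nonNeg 0≤v (*-nonNeg 0≤v 0≤v))) ⟩
      fromℕ 2 * Λ * (n * (v * (v * v)))
        ≈⟨ solve 4 (λ o l n v → o :* l :* (n :* (v :* (v :* v))) := o :* (n :* (v :* v :* v) :* l)) refl (fromℕ 2) Λ n v ⟩
      fromℕ 2 * W                       ∎

    1+M+τθ≤constant*W : 1# + M + τ * θ ≤ constant η a b * W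
    1+M+τθ≤constant*W = begin
      1# + M + τ * θ
        ≤⟨ +-mono-≤ (+-mono-≤ 1≤2W ≤-refl) τθ≤ ⟩
      fromℕ 2 * W + K * W + b * b * (fromℕ 2 * W)
        ≈⟨ solve 4 (λ o w k b → o :* w :+ k :* w :+ b :* b :* (o :* w) := (o :+ k :+ o :* (b :* b)) :* w) refl (fromℕ 2) W K b ⟩
      constant η a b * W ∎
      where
      1≤2W : 1# ≤ fromℕ 2 * W
      1≤2W = ≤-trans 1≤v (≤-trans (1≤x⇒y≤x*y 1≤v 0≤v) v²≤2W)

      τθ≤ : τ * θ ≤ b * b * (fromℕ 2 * W)
      τθ≤ = begin
        τ * θ                   ≤⟨ *-monoˡ-≤ (proj₁ 0<τ) (≤-trans (1-exp[-x]≤x (η * λ₀)) ηλ≤λ) ⟩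
        τ * λ₀                  ≤⟨ τλ≤b²v² ⟩
        b * b * (v * v)         ≤⟨ *-monoˡ-≤ (0≤x*x b) v²≤2W ⟩
        b * b * (fromℕ 2 * W)   ∎

corollary2 :
  (ℝ : RealNumbers) →
  let open RealNumbers ℝ
      open ResourceSharing ℝ
  in
  ∀ (η a b : Carrier) →
  0# < η → η < fromℕ 1 / fromℕ 3 →
  0# < a → a ≤ b →
  ∃ λ (C : Carrier) → 0# < C ×
    (∀ (N T : ℕ) → 2 ℕ.≤ N → 1 ℕ.≤ T →
     ∀ (ε : Carrier) →
     a * (fromℕ N ^ (fromℕ 1 / fromℕ 3) / fromℕ T ^ (fromℕ 1 / fromℕ 4)) ≤ ε →
     ε ≤ b * (fromℕ N ^ (fromℕ 1 / fromℕ 3) / fromℕ T ^ (fromℕ 1 / fromℕ 4)) →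
     ε ≤ fromℕ 1 / fromℕ 10 →
     ∀ (β : Vector N) →
     (∀ j → 0# ≤ β j) →
     sum β ≤ 1# →
     (∀ j → fromℕ 2 * (ε / fromℕ N) ≤ β j) →
     ∀ (L : Sequence N) →
     (∀ t → 1 ℕ.≤ t → t ℕ.≤ T → ∀ j → 0# ≤ L t j) →
     ∀ (h : Sequence N) →
     Algorithm.IsRun N ε η β L T h →
     ∀ (i : User N) →
     ∀ (h' : Sequence N) →
     (∀ t → 1 ℕ.≤ t → t ℕ.≤ T → ∀ j → 0# ≤ h' t j × h' t j ≤ 1#) →
     (∀ t → 1 ℕ.≤ t → t ℕ.≤ T → h' t i ≤ β i) →
     queue N L h T i ≤
       queue N L h' T i +
       C * (fromℕ N * fromℕ T ^ (fromℕ 3 / fromℕ 4) * log (fromℕ N * fromℕ T)))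
corollary2 ℝ η a b 0<η η<1/3 0<a a≤b = constant η a b , 0<constant 0<η 0<a , bound
  where
  open RealProperties ℝ
  open ResourceSharing ℝ
  open Estimates ℝ
  open ≤-Reasoning

  bound :
    ∀ (N T : ℕ) → 2 ℕ.≤ N → 1 ℕ.≤ T →
    ∀ (ε : Carrier) →
    a * (fromℕ N ^ (fromℕ 1 / fromℕ 3) / fromℕ T ^ (fromℕ 1 / fromℕ 4)) ≤ ε →
    ε ≤ b * (fromℕ N ^ (fromℕ 1 / fromℕ 3) / fromℕ T ^ (fromℕ 1 / fromℕ 4)) →
    ε ≤ fromℕ 1 / fromℕ 10 →
    ∀ (β : Vector N) →
    (∀ j → 0# ≤ β j) →
    sum β ≤ 1# →
    (∀ j → fromℕ 2 * (ε / fromℕ N) ≤ β j) →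
    ∀ (L : Sequence N) →
    (∀ t → 1 ℕ.≤ t → t ℕ.≤ T → ∀ j → 0# ≤ L t j) →
    ∀ (h : Sequence N) →
    Algorithm.IsRun N ε η β L T h →
    ∀ (i : User N) →
    ∀ (h' : Sequence N) →
    (∀ t → 1 ℕ.≤ t → t ℕ.≤ T → ∀ j → 0# ≤ h' t j × h' t j ≤ 1#) →
    (∀ t → 1 ℕ.≤ t → t ℕ.≤ T → h' t i ≤ β i) →
    queue N L h T i ≤
      queue N L h' T i +
      constant η a b * (fromℕ N * fromℕ T ^ (fromℕ 3 / fromℕ 4) * log (fromℕ N * fromℕ T))
  bound N (suc t) 2≤N 1≤T ε ε-lower ε-upper ε≤1/10 β _ Σβ≤1 2ε/N≤β L _ h run i h' _ h'≤β = begin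
    queue N L h T i
      ≤⟨ R.queue-bound h'≤β P.1≤ε/n*exp[θM] P.0≤M t ℕ.≤-refl ⟩
    queue N L h' T i + (1# + P.M + fromℕ T * P.θ)
      ≤⟨ +-monoʳ-≤ _ P.1+M+τθ≤constant*W ⟩
    queue N L h' T i + constant η a b * P.W
      ≈⟨ +-congˡ (*-congˡ (*-congʳ (*-congˡ (fourth-root³ (fromℕ T))))) ⟩
    queue N L h' T i + constant η a b * (fromℕ N * fromℕ T ^ (fromℕ 3 / fromℕ 4) * log (fromℕ N * fromℕ T)) ∎
    where
    T : ℕ
    T = suc t

    module P = Parameters {b = b} 0<η (≤-trans (proj₁ η<1/3) (1/[1+n]≤1 2)) 0<a 2≤N 1≤T
      ε-lower ε-upper (≤-trans ε≤1/10 (1/[1+n]≤1 9))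

    0<ε/N : 0# < ε / fromℕ N
    0<ε/N = /-pos P.0<ε P.0<n

    ε/N≤β : ∀ j → ε / fromℕ N ≤ β j
    ε/N≤β j = ≤-trans (1≤x⇒y≤x*y (1≤fromℕ {2} (ℕ.s≤s ℕ.z≤n)) (proj₁ 0<ε/N)) (2ε/N≤β j)

    module R = Dynamics.Run ℝ N {L = L} 0<ε/N 0<η P.0<λ ε/N≤β Σβ≤1 run
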